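{- Let $p\ge 5$ be an integer, let $x$ be a right vertex of $T_H$, and let $f$ be any $2p$ distance coloring of $T_H$. Then at least two distinct colors that do not appear on $V(D_x^{2p})$ appear on $\mathcal{F}_{x,p+1}\cup\mathcal{F}_{x,p+2}\cup\mathcal{F}_{x,p+3}$; that is, $$\Big|\, f\big(\mathcal{F}_{x,p+1}\cup\mathcal{F}_{x,p+2}\cup\mathcal{F}_{x,p+3}\big)\setminus f\big(V(D_x^{2p})\big)\Big|\ \ge 2 .$$ (In the paper's words: besides the new color needed on $\mathcal{F}_{x,p+1}$, a second new color must be introduced to color $\mathcal{F}_{x,p+2}\cup\mathcal{F}_{x,p+3}$.)
   Context: $T_H$ is the infinite hexagonal grid with vertex set $\mathbb{Z}^2$: $(i,j)$ is adjacent to $(i,j\pm1)$, and $(i,j)$ is adjacent to $(i+1,j)$ iff $i+j$ is even; no other edges. A vertex $(i,j)$ with $i+j$ even is called a right vertex. $d(u,v)$ is graph distance. For $l\in\mathbb{N}$, an $l$ distance coloring is a map $f:V(T_H)\to\{1,\dots,n\}$ with $f(u)\ne f(v)$ for all distinct $u,v$ with $d(u,v)\le l$. For a vertex $x$ and integer $k\ge0$, $\mathcal{F}_{x,k}=\{u\in V(T_H): d(x,u)=k\}$. $D_x^{2p}$ is the subgraph of $T_H$ induced by $\{w: d(w,x)\le p\}$. -}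

module Defs where

open import Data.Fin.Base using (Fin)
open import Data.Integer.Base as ℤ using (ℤ; 1ℤ; -1ℤ)
open import Data.Integer.Divisibility as ℤ using ()
open import Data.Nat.Base using (ℕ; zero; suc; _≤_; _<_)
open import Data.Product.Base using (_×_; _,_; ∃-syntax)
open import Level using (0ℓ)
open import Relation.Binary.Core using (Rel)
open import Relation.Binary.PropositionalEquality.Core using (_≡_; _≢_)
open import Relation.Nullary.Negation.Core using (¬_)
open import Relation.Unary using (Pred)

Vertex : Set
Vertex = ℤ × ℤ

IsRight : Pred Vertex 0ℓ
IsRight (i , j) = ℤ.+ 2 ℤ.∣ (i ℤ.+ j)

data Adj : Rel Vertex 0ℓ where
  up    : ∀ {i j} → Adj (i , j) (i , j ℤ.+ 1ℤ)
  down  : ∀ {i j} → Adj (i , j) (i , j ℤ.+ -1ℤ)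
  right : ∀ {i j} → IsRight (i , j) → Adj (i , j) (i ℤ.+ 1ℤ , j)
  -- The same horizontal edge traversed backwards: parity is tested at its
  -- left endpoint, which is here the target.
  left  : ∀ {i j} → IsRight (i , j) → Adj (i ℤ.+ 1ℤ , j) (i , j)

data Walk : Vertex → Vertex → ℕ → Set where
  []  : ∀ {u} → Walk u u zero
  _∷_ : ∀ {u v w k} → Adj u v → Walk v w k → Walk u w (suc k)

-- d u v k says that the graph distance of u and v is k.
d : Vertex → Vertex → Pred ℕ 0ℓ
d u v k = Walk u v k × (∀ {m} → m < k → ¬ Walk u v m)

d[_,_]≤_ : Vertex → Vertex → Pred ℕ 0ℓ
d[ u , v ]≤ l = ∃[ k ] d u v k × k ≤ l

IsDistanceColoring : ∀ {n} → ℕ → Pred (Vertex → Fin n) 0ℓ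
IsDistanceColoring l f = ∀ {u v} → u ≢ v → d[ u , v ]≤ l → f u ≢ f v

𝓕 : Vertex → ℕ → Pred Vertex 0ℓ
𝓕 x k u = d x u k

-- The vertex set of D_x^{2p}; the parameter is the radius p.
VD : Vertex → ℕ → Pred Vertex 0ℓ
VD x p w = d[ w , x ]≤ p

Image : ∀ {A B : Set} → (A → B) → Pred A 0ℓ → Pred B 0ℓ
Image f P c = ∃[ u ] P u × f u ≡ c

AtLeastTwo : ∀ {A : Set} → Pred A 0ℓ → Set
AtLeastTwo P = ∃[ a ] ∃[ b ] a ≢ b × P a × P b

{-# OPTIONS --safe #-}
-- The grid embeds isometrically into ℤ³ with the ℓ¹ metric, as the points with coordinate sum 0 or 1, x being the origin.
-- Call two vertices far when their distance exceeds 2p; the vertices of one colour are pairwise far. Give each vertex v at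
-- distance p − 2, …, p + 3 from x a weight w(v) such that every pairwise far set has weight at most 7. A colour of the ball
-- is used there by exactly one vertex b, so its class outside the ball has weight at most 7 − w(b), and only vertices b at
-- distance at least p − 2 matter. With at most one new colour, the outer weights would add up to at most 7 + Σ (7 − w(b)),
-- but they add up to more.
--
-- That far sets are light comes from counting overlaps: the distance of u and v is ‖u‖ + ‖v‖ minus twice the overlap of
-- their coordinates of equal sign, so overlaps of far vertices are tiny. For large p this forces large coordinates of
-- distinct vertices to lie on distinct signed axes, so at most three vertices can be pairwise far. Small p are checked by
-- evaluation.
module Submission where

open import Defs
open import Data.Bool.Base using (Bool; true; false; T; _∧_)
open import Data.Bool.ListAction using (all)
import Data.Bool.Properties as Bool
open import Data.Fin.Base using (Fin; zero; suc)
import Data.Fin.Properties as Fin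
open import Data.Integer.Base as ℤ using (ℤ; 0ℤ; 1ℤ; -1ℤ; ∣_∣; +_; -[1+_])
import Data.Integer.DivMod as ℤ
import Data.Integer.Divisibility.Signed as Signed
import Data.Integer.Properties as ℤ
import Data.Integer.Tactic.RingSolver as ℤ-Solver
open import Data.List.Base using (List; []; _∷_; length; map; concatMap; applyUpTo; null; filter)
import Data.List.Membership.DecPropositional as DecMembership
open import Data.List.Membership.Propositional using (_∈_; find)
open import Data.List.Membership.Propositional.Properties
  using (∈-concatMap⁺; ∈-applyUpTo⁺; ∈-filter⁺; ∈-filter⁻; ∈-map⁺)
import Data.List.Properties as List
open import Data.List.Relation.Unary.All as All using (All; []; _∷_)
import Data.List.Relation.Unary.All.Properties as All
open import Data.List.Relation.Unary.AllPairs as AllPairs using (AllPairs; []; _∷_)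
import Data.List.Relation.Unary.AllPairs.Properties as AllPairs
open import Data.List.Relation.Unary.Any as Any using (here; there)
open import Data.List.Relation.Unary.Unique.Propositional using (Unique)
import Data.List.Relation.Unary.Unique.DecPropositional as DecUnique
import Data.List.Relation.Unary.Unique.Propositional.Properties as Unique
open import Data.Nat.Base
open import Data.Nat.ListAction using (sum)
open import Data.Nat.ListAction.Properties using (sum-++)
open import Data.Nat.Properties
import Data.Nat.Tactic.RingSolver as ℕ-Solver
open import Data.Product.Base using (_×_; _,_; ∃-syntax; proj₁; proj₂)
open import Data.Product.Properties using (≡-dec)
open import Data.Sum.Base using (_⊎_; inj₁; inj₂)
open import Function.Base using (_∘_; case_of_)
open import Function.Bundles using (Equivalence)
open import Relation.Binary.Definitions using (DecidableEquality)
open import Relation.Binary.PropositionalEquality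
open import Relation.Nullary
  using (Dec; ¬_; contradiction; from-no; ¬?; yes; no; _→-dec_; _×-dec_; _⊎-dec_)
open import Relation.Nullary.Decidable using (toWitness)
open import Relation.Unary using (Pred; Decidable; _∪_; _∖_)
open import Algebra.Properties.AbelianGroup ℤ.+-0-abelianGroup using (∙-cancelˡ; ∙-cancelʳ)

-- The cubic metric

Cube : Set
Cube = ℤ × ℤ × ℤ

total : Cube → ℤ
total (a , b , c) = a ℤ.+ b ℤ.+ c

IsCube : Cube → Set
IsCube u = total u ≡ 0ℤ ⊎ total u ≡ 1ℤ

norm : Cube → ℕ
norm (a , b , c) = ∣ a ∣ + ∣ b ∣ + ∣ c ∣

dist : Cube → Cube → ℕ
dist (a , b , c) (a′ , b′ , c′) = ∣ a ℤ.- a′ ∣ + ∣ b ℤ.- b′ ∣ + ∣ c ℤ.- c′ ∣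

origin : Cube
origin = 0ℤ , 0ℤ , 0ℤ

shift : Fin 3 → ℤ → Cube → Cube
shift zero             ε (a , b , c) = a ℤ.+ ε , b , c
shift (suc zero)       ε (a , b , c) = a , b ℤ.+ ε , c
shift (suc (suc zero)) ε (a , b , c) = a , b , c ℤ.+ ε

total-shift : ∀ i ε u → total (shift i ε u) ≡ total u ℤ.+ ε
total-shift zero             ε (a , b , c) = lem a b c ε
  where lem : ∀ a b c ε → a ℤ.+ ε ℤ.+ b ℤ.+ c ≡ a ℤ.+ b ℤ.+ c ℤ.+ ε
        lem = ℤ-Solver.solve-∀
total-shift (suc zero)       ε (a , b , c) = lem a b c ε
  where lem : ∀ a b c ε → a ℤ.+ (b ℤ.+ ε) ℤ.+ c ≡ a ℤ.+ b ℤ.+ c ℤ.+ ε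
        lem = ℤ-Solver.solve-∀
total-shift (suc (suc zero)) ε (a , b , c) = sym (ℤ.+-assoc (a ℤ.+ b) c ε)

dist-self : ∀ u → dist u u ≡ 0
dist-self (a , b , c) rewrite ℤ.+-inverseʳ a | ℤ.+-inverseʳ b | ℤ.+-inverseʳ c = refl

dist-sym : ∀ u v → dist u v ≡ dist v u
dist-sym (a , b , c) (a′ , b′ , c′) =
  cong₂ _+_ (cong₂ _+_ (ℤ.∣i-j∣≡∣j-i∣ a a′) (ℤ.∣i-j∣≡∣j-i∣ b b′)) (ℤ.∣i-j∣≡∣j-i∣ c c′)

dist-origin : ∀ u → dist u origin ≡ norm u
dist-origin (a , b , c) =
  cong₂ _+_ (cong₂ _+_ (cong ∣_∣ (ℤ.+-identityʳ a)) (cong ∣_∣ (ℤ.+-identityʳ b))) (cong ∣_∣ (ℤ.+-identityʳ c))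

dist≡0⇒≡ : ∀ u v → dist u v ≡ 0 → u ≡ v
dist≡0⇒≡ (a , b , c) (a′ , b′ , c′) e =
  cong₂ _,_ (eq a a′ (m+n≡0⇒m≡0 _ ab)) (cong₂ _,_ (eq b b′ (m+n≡0⇒n≡0 ∣ a ℤ.- a′ ∣ ab)) (eq c c′ (m+n≡0⇒n≡0 (∣ a ℤ.- a′ ∣ + ∣ b ℤ.- b′ ∣) e)))
  where
  ab = m+n≡0⇒m≡0 (∣ a ℤ.- a′ ∣ + ∣ b ℤ.- b′ ∣) e
  eq : ∀ i j → ∣ i ℤ.- j ∣ ≡ 0 → i ≡ j
  eq i j p = ℤ.i-j≡0⇒i≡j i j (ℤ.∣i∣≡0⇒i≡0 p)

dist-triangle : ∀ u v w → dist u w ≤ dist u v + dist v w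
dist-triangle (a , b , c) (a′ , b′ , c′) (a″ , b″ , c″) = begin
  dist (a , b , c) (a″ , b″ , c″)
    ≤⟨ +-mono-≤ (+-mono-≤ (tri a a′ a″) (tri b b′ b″)) (tri c c′ c″) ⟩
  (∣ a ℤ.- a′ ∣ + ∣ a′ ℤ.- a″ ∣) + (∣ b ℤ.- b′ ∣ + ∣ b′ ℤ.- b″ ∣) + (∣ c ℤ.- c′ ∣ + ∣ c′ ℤ.- c″ ∣)
    ≡⟨ rearrange (∣ a ℤ.- a′ ∣) _ (∣ b ℤ.- b′ ∣) _ (∣ c ℤ.- c′ ∣) _ ⟩
  dist (a , b , c) (a′ , b′ , c′) + dist (a′ , b′ , c′) (a″ , b″ , c″) ∎
  where
  open ≤-Reasoning
  split : ∀ i j k → i ℤ.- k ≡ (i ℤ.- j) ℤ.+ (j ℤ.- k)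
  split = ℤ-Solver.solve-∀
  tri : ∀ i j k → ∣ i ℤ.- k ∣ ≤ ∣ i ℤ.- j ∣ + ∣ j ℤ.- k ∣
  tri i j k = subst (λ z → ∣ z ∣ ≤ ∣ i ℤ.- j ∣ + ∣ j ℤ.- k ∣) (sym (split i j k)) (ℤ.∣i+j∣≤∣i∣+∣j∣ (i ℤ.- j) (j ℤ.- k))
  rearrange : ∀ m m′ n n′ o o′ → (m + m′) + (n + n′) + (o + o′) ≡ (m + n + o) + (m′ + n′ + o′)
  rearrange = ℕ-Solver.solve-∀

dist-shift : ∀ i ε u → dist u (shift i ε u) ≡ ∣ ε ∣
dist-shift zero ε (a , b , c) rewrite ℤ.+-inverseʳ b | ℤ.+-inverseʳ c =
  trans (+-identityʳ _) (trans (+-identityʳ _) (trans (cong ∣_∣ (lem a ε)) (ℤ.∣-i∣≡∣i∣ ε)))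
  where lem : ∀ a ε → a ℤ.- (a ℤ.+ ε) ≡ ℤ.- ε
        lem = ℤ-Solver.solve-∀
dist-shift (suc zero) ε (a , b , c) rewrite ℤ.+-inverseʳ a | ℤ.+-inverseʳ c =
  trans (+-identityʳ _) (trans (cong ∣_∣ (lem b ε)) (ℤ.∣-i∣≡∣i∣ ε))
  where lem : ∀ a ε → a ℤ.- (a ℤ.+ ε) ≡ ℤ.- ε
        lem = ℤ-Solver.solve-∀
dist-shift (suc (suc zero)) ε (a , b , c) rewrite ℤ.+-inverseʳ a | ℤ.+-inverseʳ b =
  trans (cong ∣_∣ (lem c ε)) (ℤ.∣-i∣≡∣i∣ ε)
  where lem : ∀ a ε → a ℤ.- (a ℤ.+ ε) ≡ ℤ.- ε
        lem = ℤ-Solver.solve-∀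

-- The hexagonal grid inside the cubic lattice

∣-+1∣ : ∀ i j {n} → i ℤ.- j ≡ -[1+ n ] → suc ∣ i ℤ.+ 1ℤ ℤ.- j ∣ ≡ ∣ i ℤ.- j ∣
∣-+1∣ i j {n} e = trans (cong (λ z → suc ∣ z ∣) (trans (lem i j) (cong (ℤ._+ 1ℤ) e))) (trans (abs n) (cong ∣_∣ (sym e)))
  where
  lem : ∀ i j → i ℤ.+ 1ℤ ℤ.- j ≡ (i ℤ.- j) ℤ.+ 1ℤ
  lem = ℤ-Solver.solve-∀
  abs : ∀ n → suc ∣ -[1+ n ] ℤ.+ 1ℤ ∣ ≡ suc n
  abs zero    = refl
  abs (suc n) = refl

∣-−1∣ : ∀ i j {n} → i ℤ.- j ≡ + suc n → suc ∣ i ℤ.+ -1ℤ ℤ.- j ∣ ≡ ∣ i ℤ.- j ∣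
∣-−1∣ i j {n} e = trans (cong (λ z → suc ∣ z ∣) (trans (lem i j) (cong (ℤ._+ -1ℤ) e))) (cong ∣_∣ (sym e))
  where
  lem : ∀ i j → i ℤ.+ -1ℤ ℤ.- j ≡ (i ℤ.- j) ℤ.+ -1ℤ
  lem = ℤ-Solver.solve-∀

total-− : ∀ a b c a′ b′ c′ → (a ℤ.- a′) ℤ.+ (b ℤ.- b′) ℤ.+ (c ℤ.- c′) ≡ (a ℤ.+ b ℤ.+ c) ℤ.- (a′ ℤ.+ b′ ℤ.+ c′)
total-− = ℤ-Solver.solve-∀

suc-1st : ∀ {k l m k′ : ℕ} → suc k′ ≡ k → suc (k′ + l + m) ≡ k + l + m
suc-1st refl = refl
suc-2nd : ∀ {k l m l′ : ℕ} → suc l′ ≡ l → suc (k + l′ + m) ≡ k + l + m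
suc-2nd {k} {m = m} {l′} refl = cong (_+ m) (sym (+-suc k l′))
suc-3rd : ∀ {k l m m′ : ℕ} → suc m′ ≡ m → suc (k + l + m′) ≡ k + l + m
suc-3rd {k} {l} {m′ = m′} refl = sym (+-suc (k + l) m′)

signed : ∀ i → (∃[ n ] i ≡ -[1+ n ]) ⊎ (∃[ n ] i ≡ + n)
signed (+ n)    = inj₂ (n , refl)
signed -[1+ n ] = inj₁ (n , refl)

-- The coordinate differences of `u` and `v` add up to minus the total of `v`, which is at most 0.
-- If none of them is negative, all vanish, against `dist u v ≢ 0`; otherwise raising a coordinate
-- with a negative difference brings `u` closer.
closer⁺ : ∀ u v → total u ≡ 0ℤ → IsCube v → dist u v ≢ 0 → ∃[ i ] suc (dist (shift i 1ℤ u) v) ≡ dist u v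
closer⁺ (a , b , c) (a′ , b′ , c′) t q ≢0
  with signed (a ℤ.- a′) | signed (b ℤ.- b′) | signed (c ℤ.- c′)
... | inj₁ (_ , ea) | _ | _ = zero , suc-1st (∣-+1∣ a a′ ea)
... | inj₂ _ | inj₁ (_ , eb) | _ = suc zero , suc-2nd {∣ a ℤ.- a′ ∣} (∣-+1∣ b b′ eb)
... | inj₂ _ | inj₂ _ | inj₁ (_ , ec) = suc (suc zero) , suc-3rd {∣ a ℤ.- a′ ∣} (∣-+1∣ c c′ ec)
... | inj₂ (k , ea) | inj₂ (l , eb) | inj₂ (m , ec) = contradiction (trans (cong₂ _+_ (cong₂ _+_ (cong ∣_∣ ea) (cong ∣_∣ eb)) (cong ∣_∣ ec)) (n≤0⇒n≡0 (ℤ.drop‿+≤+ (subst (ℤ._≤ 0ℤ) (sym sum≡) (nonpos q))))) ≢0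
  where
  sum≡ : + (k + l + m) ≡ 0ℤ ℤ.- (a′ ℤ.+ b′ ℤ.+ c′)
  sum≡ = trans (cong₂ ℤ._+_ (cong₂ ℤ._+_ (sym ea) (sym eb)) (sym ec))
           (trans (total-− a b c a′ b′ c′) (cong (ℤ._- (a′ ℤ.+ b′ ℤ.+ c′)) t))
  nonpos : IsCube (a′ , b′ , c′) → 0ℤ ℤ.- (a′ ℤ.+ b′ ℤ.+ c′) ℤ.≤ 0ℤ
  nonpos (inj₁ e) = ℤ.≤-reflexive (cong (λ z → 0ℤ ℤ.- z) e)
  nonpos (inj₂ e) = ℤ.≤-trans (ℤ.≤-reflexive (cong (λ z → 0ℤ ℤ.- z) e)) ℤ.-≤+

neg≡-[1+]⇒≡+suc : ∀ {i n} → ℤ.- i ≡ -[1+ n ] → i ≡ + suc n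
neg≡-[1+]⇒≡+suc {i} e = trans (sym (ℤ.neg-involutive i)) (cong ℤ.-_ e)

-- The differences now add up to 1 minus the total of `v`, which is nonnegative, so some difference
-- is positive unless all vanish. They are negated so that `signed` singles out the positive ones.
closer⁻ : ∀ u v → total u ≡ 1ℤ → IsCube v → dist u v ≢ 0 → ∃[ i ] suc (dist (shift i -1ℤ u) v) ≡ dist u v
closer⁻ (a , b , c) (a′ , b′ , c′) t q ≢0
  with signed (ℤ.- (a ℤ.- a′)) | signed (ℤ.- (b ℤ.- b′)) | signed (ℤ.- (c ℤ.- c′))
... | inj₁ (_ , ea) | _ | _ = zero , suc-1st (∣-−1∣ a a′ (neg≡-[1+]⇒≡+suc ea))
... | inj₂ _ | inj₁ (_ , eb) | _ = suc zero , suc-2nd {∣ a ℤ.- a′ ∣} (∣-−1∣ b b′ (neg≡-[1+]⇒≡+suc eb))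
... | inj₂ _ | inj₂ _ | inj₁ (_ , ec) = suc (suc zero) , suc-3rd {∣ a ℤ.- a′ ∣} (∣-−1∣ c c′ (neg≡-[1+]⇒≡+suc ec))
... | inj₂ (k , ea) | inj₂ (l , eb) | inj₂ (m , ec) = contradiction (trans (cong₂ _+_ (cong₂ _+_ (abs ea) (abs eb)) (abs ec)) (n≤0⇒n≡0 (ℤ.drop‿+≤+ (subst (ℤ._≤ 0ℤ) (sym sum≡) (nonpos q))))) ≢0
  where
  abs : ∀ {i n} → ℤ.- i ≡ + n → ∣ i ∣ ≡ n
  abs {i} e = trans (sym (ℤ.∣-i∣≡∣i∣ i)) (cong ∣_∣ e)
  lem : ∀ i j k → ℤ.- i ℤ.+ ℤ.- j ℤ.+ ℤ.- k ≡ ℤ.- (i ℤ.+ j ℤ.+ k)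
  lem = ℤ-Solver.solve-∀
  sum≡ : + (k + l + m) ≡ ℤ.- (1ℤ ℤ.- (a′ ℤ.+ b′ ℤ.+ c′))
  sum≡ = trans (cong₂ ℤ._+_ (cong₂ ℤ._+_ (sym ea) (sym eb)) (sym ec))
           (trans (lem (a ℤ.- a′) (b ℤ.- b′) (c ℤ.- c′)) (cong ℤ.-_ (trans (total-− a b c a′ b′ c′) (cong (ℤ._- (a′ ℤ.+ b′ ℤ.+ c′)) t))))
  nonpos : IsCube (a′ , b′ , c′) → ℤ.- (1ℤ ℤ.- (a′ ℤ.+ b′ ℤ.+ c′)) ℤ.≤ 0ℤ
  nonpos (inj₁ e) = ℤ.≤-trans (ℤ.≤-reflexive (cong (λ z → ℤ.- (1ℤ ℤ.- z)) e)) ℤ.-≤+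
  nonpos (inj₂ e) = ℤ.≤-reflexive (cong (λ z → ℤ.- (1ℤ ℤ.- z)) e)

2∤1 : ¬ (+ 2 Signed.∣ 1ℤ)
2∤1 = from-no (+ 2 Signed.∣? 1ℤ)

module Lattice (x₁ x₂ : ℤ) (x-right : IsRight (x₁ , x₂)) where

  -- With y + z = s − x, the vertex (i , j) has i = x and j = y − z. The neighbours of a vertex of total 0 (a right one) are
  -- obtained by increasing one coordinate, those of a vertex of total 1 by decreasing one; j alone fixes the total modulo 2.
  emb : Cube → Vertex
  emb (a , b , c) = x₁ ℤ.+ a , x₂ ℤ.+ (b ℤ.- c)

  2∣x : + 2 Signed.∣ x₁ ℤ.+ x₂
  2∣x = Signed.∣ᵤ⇒∣ x-right

  total-mod-2 : ∀ u → let (i , j) = emb u in i ℤ.+ j ≡ (x₁ ℤ.+ x₂) ℤ.+ total u ℤ.+ (ℤ.- proj₂ (proj₂ u)) ℤ.* + 2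
  total-mod-2 (a , b , c) = lem x₁ x₂ a b c
    where lem : ∀ x₁ x₂ a b c → (x₁ ℤ.+ a) ℤ.+ (x₂ ℤ.+ (b ℤ.- c)) ≡ (x₁ ℤ.+ x₂) ℤ.+ (a ℤ.+ b ℤ.+ c) ℤ.+ (ℤ.- c) ℤ.* + 2
          lem = ℤ-Solver.solve-∀

  emb-right : ∀ u → total u ≡ 0ℤ → IsRight (emb u)
  emb-right u@(a , b , c) t = Signed.∣⇒∣ᵤ (subst (+ 2 Signed.∣_) (sym (total-mod-2 u))
    (Signed.∣m∣n⇒∣m+n (Signed.∣m∣n⇒∣m+n 2∣x (subst (+ 2 Signed.∣_) (sym t) (Signed.divides 0ℤ refl)))
                      (Signed.divides (ℤ.- c) refl)))

  right-total : ∀ u → IsRight (emb u) → + 2 Signed.∣ total u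
  right-total u@(a , b , c) r = Signed.∣m+n∣m⇒∣n
    (Signed.∣m+n∣n⇒∣m (subst (+ 2 Signed.∣_) (total-mod-2 u) (Signed.∣ᵤ⇒∣ r)) (Signed.divides (ℤ.- c) refl)) 2∣x

  right-total-0 : ∀ {u} → IsCube u → IsRight (emb u) → total u ≡ 0ℤ
  right-total-0 (inj₁ t) r = t
  right-total-0 {u} (inj₂ t) r = contradiction (subst (+ 2 Signed.∣_) t (right-total u r)) 2∤1

  Neighbours : Cube → Vertex → Set
  Neighbours u w = ∃[ i ] (total u ≡ 0ℤ × w ≡ emb (shift i 1ℤ u) ⊎ total u ≡ 1ℤ × w ≡ emb (shift i -1ℤ u))

  emb-a : ∀ ε a b c → (x₁ ℤ.+ a ℤ.+ ε , x₂ ℤ.+ (b ℤ.- c)) ≡ emb (a ℤ.+ ε , b , c)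
  emb-a ε a b c = cong (_, x₂ ℤ.+ (b ℤ.- c)) (ℤ.+-assoc x₁ a ε)

  emb-b : ∀ ε a b c → (x₁ ℤ.+ a , x₂ ℤ.+ (b ℤ.- c) ℤ.+ ε) ≡ emb (a , b ℤ.+ ε , c)
  emb-b ε a b c = cong (x₁ ℤ.+ a ,_) (lem x₂ b c ε)
    where lem : ∀ x b c ε → x ℤ.+ (b ℤ.- c) ℤ.+ ε ≡ x ℤ.+ (b ℤ.+ ε ℤ.- c)
          lem = ℤ-Solver.solve-∀

  emb-c : ∀ ε a b c → (x₁ ℤ.+ a , x₂ ℤ.+ (b ℤ.- c) ℤ.+ (ℤ.- ε)) ≡ emb (a , b , c ℤ.+ ε)
  emb-c ε a b c = cong (x₁ ℤ.+ a ,_) (lem x₂ b c ε)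
    where lem : ∀ x b c ε → x ℤ.+ (b ℤ.- c) ℤ.+ (ℤ.- ε) ≡ x ℤ.+ (b ℤ.- (c ℤ.+ ε))
          lem = ℤ-Solver.solve-∀

  -- The source is a variable tied to `emb u` by an equation, because the index `i ℤ.+ 1ℤ` of `left`
  -- does not unify with a coordinate of `emb u`.
  adj⇒neighbours : ∀ {u v w} → Adj v w → v ≡ emb u → IsCube u → Neighbours u w
  adj⇒neighbours {a , b , c} up   refl (inj₁ t) = suc zero , inj₁ (t , emb-b 1ℤ a b c)
  adj⇒neighbours {a , b , c} up   refl (inj₂ t) = suc (suc zero) , inj₂ (t , emb-c -1ℤ a b c)
  adj⇒neighbours {a , b , c} down refl (inj₁ t) = suc (suc zero) , inj₁ (t , emb-c 1ℤ a b c)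
  adj⇒neighbours {a , b , c} down refl (inj₂ t) = suc zero , inj₂ (t , emb-b -1ℤ a b c)
  adj⇒neighbours {u@(a , b , c)} (right r) refl p = zero , inj₁ (right-total-0 {u} p r , emb-a 1ℤ a b c)
  adj⇒neighbours {u@(a , b , c)} (left {i} {j} r) e p = zero , inj₂ (t p , e′)
    where
    lem : ∀ i → i ≡ i ℤ.+ 1ℤ ℤ.+ -1ℤ
    lem = ℤ-Solver.solve-∀
    e′ : (i , j) ≡ emb (shift zero -1ℤ u)
    e′ = trans (cong₂ _,_ (trans (lem i) (cong (ℤ._+ -1ℤ) (cong proj₁ e))) (cong proj₂ e)) (emb-a -1ℤ a b c)
    t : IsCube u → total u ≡ 1ℤ
    t (inj₂ t) = t
    -- With total 0 at `u` the target would have total -1, but it is a right vertex and so has an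
    -- even total.
    t (inj₁ t) = contradiction (Signed.∣m⇒∣-m (subst (+ 2 Signed.∣_) (trans (total-shift zero -1ℤ u) (cong (ℤ._+ -1ℤ) t))
                                  (right-total (shift zero -1ℤ u) (subst IsRight e′ r)))) 2∤1

  shift⁺-isCube : ∀ i u → total u ≡ 0ℤ → IsCube (shift i 1ℤ u)
  shift⁺-isCube i u t = inj₂ (trans (total-shift i 1ℤ u) (cong (ℤ._+ 1ℤ) t))

  shift⁻-isCube : ∀ i u → total u ≡ 1ℤ → IsCube (shift i -1ℤ u)
  shift⁻-isCube i u t = inj₁ (trans (total-shift i -1ℤ u) (cong (ℤ._+ -1ℤ) t))

  adj⁺ : ∀ i u → total u ≡ 0ℤ → Adj (emb u) (emb (shift i 1ℤ u))
  adj⁺ zero             u@(a , b , c) t = subst (Adj (emb u)) (emb-a 1ℤ a b c) (right (emb-right u t))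
  adj⁺ (suc zero)       u@(a , b , c) t = subst (Adj (emb u)) (emb-b 1ℤ a b c) up
  adj⁺ (suc (suc zero)) u@(a , b , c) t = subst (Adj (emb u)) (emb-c 1ℤ a b c) down

  adj⁻ : ∀ i u → total u ≡ 1ℤ → Adj (emb u) (emb (shift i -1ℤ u))
  adj⁻ zero u@(a , b , c) t = subst (λ v → Adj v (emb w)) e (left (emb-right w t′))
    where
    w = shift zero -1ℤ u
    t′ : total w ≡ 0ℤ
    t′ = trans (total-shift zero -1ℤ u) (cong (ℤ._+ -1ℤ) t)
    lem : ∀ x a → x ℤ.+ (a ℤ.+ -1ℤ) ℤ.+ 1ℤ ≡ x ℤ.+ a
    lem = ℤ-Solver.solve-∀
    e : (x₁ ℤ.+ (a ℤ.+ -1ℤ) ℤ.+ 1ℤ , x₂ ℤ.+ (b ℤ.- c)) ≡ emb u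
    e = cong (_, x₂ ℤ.+ (b ℤ.- c)) (lem x₁ a)
  adj⁻ (suc zero)       u@(a , b , c) t = subst (Adj (emb u)) (emb-b -1ℤ a b c) down
  adj⁻ (suc (suc zero)) u@(a , b , c) t = subst (Adj (emb u)) (emb-c -1ℤ a b c) up

  -- The image determines `a` and `b ℤ.- c`, and its parity determines the total, which is 0 or 1.
  -- Subtracting the first two from the total leaves twice `c`.
  emb-injective : ∀ {u v} → IsCube u → IsCube v → emb u ≡ emb v → u ≡ v
  emb-injective {u@(a , b , c)} {v@(a′ , b′ , c′)} p q e =
    cong₂ _,_ a≡a′ (cong₂ _,_ b≡b′ c≡c′)
    where
    a≡a′ : a ≡ a′
    a≡a′ = ∙-cancelˡ x₁ a a′ (cong proj₁ e)
    b-c : b ℤ.- c ≡ b′ ℤ.- c′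
    b-c = ∙-cancelˡ x₂ (b ℤ.- c) (b′ ℤ.- c′) (cong proj₂ e)
    double : ∀ a b c → (a ℤ.+ b ℤ.+ c) ℤ.- a ℤ.- (b ℤ.- c) ≡ c ℤ.* + 2
    double = ℤ-Solver.solve-∀
    t≡t′ : IsCube u → IsCube v → total u ≡ total v
    t≡t′ (inj₁ t) (inj₁ t′) = trans t (sym t′)
    t≡t′ (inj₂ t) (inj₂ t′) = trans t (sym t′)
    t≡t′ (inj₁ t) (inj₂ t′) = contradiction (subst (+ 2 Signed.∣_) t′ (right-total v (subst IsRight e (emb-right u t)))) 2∤1
    t≡t′ (inj₂ t) (inj₁ t′) = contradiction (subst (+ 2 Signed.∣_) t (right-total u (subst IsRight (sym e) (emb-right v t′)))) 2∤1
    c≡c′ : c ≡ c′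
    c≡c′ = ℤ.*-cancelʳ-≡ c c′ (+ 2) (trans (sym (double a b c))
             (trans (cong₂ ℤ._-_ (cong₂ ℤ._-_ (t≡t′ p q) a≡a′) b-c) (double a′ b′ c′)))
    b≡b′ : b ≡ b′
    b≡b′ = ∙-cancelʳ (ℤ.- c) b b′ (trans b-c (cong (λ z → b′ ℤ.- z) (sym c≡c′)))

  -- The sum of the two displacements from x is divided by 2: the quotient gives the last coordinate
  -- up to sign, and the remainder is the total.
  emb-surjective : ∀ w → ∃[ u ] IsCube u × w ≡ emb u
  emb-surjective (i , j) = u , isCube (bit s (ℤ.n%ℕd<d ((i ℤ.- x₁) ℤ.+ (j ℤ.- x₂)) 2)) , cong₂ _,_ (sym (lem₁ x₁ i)) (sym (lem₂ x₂ j k))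
    where
    s = ((i ℤ.- x₁) ℤ.+ (j ℤ.- x₂)) ℤ.%ℕ 2
    k = ((i ℤ.- x₁) ℤ.+ (j ℤ.- x₂)) ℤ./ℕ 2
    u : Cube
    u = i ℤ.- x₁ , (j ℤ.- x₂) ℤ.- k , ℤ.- k
    lem₁ : ∀ x i → x ℤ.+ (i ℤ.- x) ≡ i
    lem₁ = ℤ-Solver.solve-∀
    lem₂ : ∀ x j k → x ℤ.+ ((j ℤ.- x ℤ.- k) ℤ.- (ℤ.- k)) ≡ j
    lem₂ = ℤ-Solver.solve-∀
    lem₃ : ∀ I J k → I ℤ.+ (J ℤ.- k) ℤ.+ (ℤ.- k) ≡ (I ℤ.+ J) ℤ.- k ℤ.* + 2
    lem₃ = ℤ-Solver.solve-∀
    lem₄ : ∀ s k → (s ℤ.+ k ℤ.* + 2) ℤ.- k ℤ.* + 2 ≡ s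
    lem₄ = ℤ-Solver.solve-∀
    total≡s : total u ≡ + s
    total≡s = trans (lem₃ (i ℤ.- x₁) (j ℤ.- x₂) k)
                (trans (cong (ℤ._- k ℤ.* + 2) (ℤ.a≡a%ℕn+[a/ℕn]*n ((i ℤ.- x₁) ℤ.+ (j ℤ.- x₂)) 2)) (lem₄ (+ s) k))
    bit : ∀ s → s < 2 → + s ≡ 0ℤ ⊎ + s ≡ 1ℤ
    bit 0 _ = inj₁ refl
    bit 1 _ = inj₂ refl
    bit (suc (suc _)) (s≤s (s≤s ()))
    isCube : + s ≡ 0ℤ ⊎ + s ≡ 1ℤ → IsCube u
    isCube (inj₁ e) = inj₁ (trans total≡s e)
    isCube (inj₂ e) = inj₂ (trans total≡s e)

  -- An edge changes one coordinate by 1, so by the triangle inequality no step lowers the distance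
  -- to the end by more than 1.
  walk⇒dist : ∀ {u v w k} → IsCube u → IsCube v → w ≡ emb u → Walk w (emb v) k → dist u v ≤ k
  walk⇒dist {u} {v} p q e [] with refl ← emb-injective p q (sym e) = ≤-reflexive (dist-self u)
  walk⇒dist {u} {v} p q e (s ∷ ws) with adj⇒neighbours s e p
  ... | i , inj₁ (t , e′) = ≤-trans (dist-triangle u (shift i 1ℤ u) v)
                              (+-mono-≤ (≤-reflexive (dist-shift i 1ℤ u)) (walk⇒dist (shift⁺-isCube i u t) q e′ ws))
  ... | i , inj₂ (t , e′) = ≤-trans (dist-triangle u (shift i -1ℤ u) v)
                              (+-mono-≤ (≤-reflexive (dist-shift i -1ℤ u)) (walk⇒dist (shift⁻-isCube i u t) q e′ ws))

  -- Greedy descent along `closer⁺` and `closer⁻`, which alternate because each step switches the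
  -- total between 0 and 1.
  dist⇒walk : ∀ {u v} n → IsCube u → IsCube v → dist u v ≡ n → Walk (emb u) (emb v) n
  dist⇒walk {u} {v} zero p q e with refl ← dist≡0⇒≡ u v e = []
  dist⇒walk {u} {v} (suc n) (inj₁ t) q e with closer⁺ u v t q (λ z → case trans (sym z) e of λ ())
  ... | i , c = adj⁺ i u t ∷ dist⇒walk n (shift⁺-isCube i u t) q (suc-injective (trans c e))
  dist⇒walk {u} {v} (suc n) (inj₂ t) q e with closer⁻ u v t q (λ z → case trans (sym z) e of λ ())
  ... | i , c = adj⁻ i u t ∷ dist⇒walk n (shift⁻-isCube i u t) q (suc-injective (trans c e))

  emb-d : ∀ {u v} → IsCube u → IsCube v → d (emb u) (emb v) (dist u v)
  emb-d p q = dist⇒walk _ p q refl , λ m< w → <⇒≱ m< (walk⇒dist p q refl w)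

-- Far lists are light

infix 9 _⁺ _⁻
infix 7 _⋒_
_⁺ _⁻ : ℤ → ℕ
(+ n) ⁺    = n
-[1+ n ] ⁺ = 0
(+ n) ⁻    = 0
-[1+ n ] ⁻ = suc n

-- The overlap of two integers: the length of the common part of the segments joining them to 0. At
-- least one of the two summands is always 0.
_⋒_ : ℤ → ℤ → ℕ
i ⋒ j = i ⁺ ⊓ j ⁺ + i ⁻ ⊓ j ⁻

⁺+⁻ : ∀ i → i ⁺ + i ⁻ ≡ ∣ i ∣
⁺+⁻ (+ n)    = +-identityʳ n
⁺+⁻ -[1+ n ] = refl

⁺-⁻ : ∀ i → + (i ⁺) ≡ + (i ⁻) ℤ.+ i
⁺-⁻ (+ n)    = refl
⁺-⁻ -[1+ n ] = sym (ℤ.+-inverseʳ (+ suc n))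

⋒-comm : ∀ i j → i ⋒ j ≡ j ⋒ i
⋒-comm i j = cong₂ _+_ (⊓-comm (i ⁺) (j ⁺)) (⊓-comm (i ⁻) (j ⁻))

∣⊖∣+⊓ : ∀ m n → ∣ m ℤ.⊖ n ∣ + 2 * (m ⊓ n) ≡ m + n
∣⊖∣+⊓ m n with ≤-total m n
... | inj₁ m≤n rewrite ℤ.∣⊖∣-≤ m≤n | m≤n⇒m⊓n≡m m≤n = begin
  n ∸ m + (m + (m + 0)) ≡⟨ +-assoc (n ∸ m) m (m + 0) ⟨
  n ∸ m + m + (m + 0)   ≡⟨ cong₂ _+_ (m∸n+n≡m m≤n) (+-identityʳ m) ⟩
  n + m                 ≡⟨ +-comm n m ⟩
  m + n                 ∎
  where open ≡-Reasoning
... | inj₂ n≤m rewrite ℤ.∣m⊖n∣≡∣n⊖m∣ m n | ℤ.∣⊖∣-≤ n≤m | m≥n⇒m⊓n≡n n≤m = begin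
  m ∸ n + (n + (n + 0)) ≡⟨ +-assoc (m ∸ n) n (n + 0) ⟨
  m ∸ n + n + (n + 0)   ≡⟨ cong₂ _+_ (m∸n+n≡m n≤m) (+-identityʳ n) ⟩
  m + n                 ∎
  where open ≡-Reasoning

∣-∣+⋒ : ∀ i j → ∣ i ℤ.- j ∣ + 2 * (i ⋒ j) ≡ ∣ i ∣ + ∣ j ∣
∣-∣+⋒ (+ m) (+ n) rewrite ℤ.[+m]-[+n]≡m⊖n m n | +-identityʳ (m ⊓ n) = ∣⊖∣+⊓ m n
∣-∣+⋒ (+ m) -[1+ n ] rewrite ⊓-zeroʳ m = +-identityʳ _
∣-∣+⋒ -[1+ m ] (+ zero) = refl
∣-∣+⋒ -[1+ m ] (+ suc n) = trans (+-identityʳ _) (cong suc (sym (+-suc m n)))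
∣-∣+⋒ -[1+ m ] -[1+ n ] =
  trans (cong (_+ 2 * (suc m ⊓ suc n)) (ℤ.∣m⊖n∣≡∣n⊖m∣ (suc n) (suc m))) (∣⊖∣+⊓ (suc m) (suc n))

coord : Cube → Fin 3 → ℤ
coord (a , b , c) zero             = a
coord (a , b , c) (suc zero)       = b
coord (a , b , c) (suc (suc zero)) = c

sum₃ : (Fin 3 → ℕ) → ℕ
sum₃ x = x zero + x (suc zero) + x (suc (suc zero))

shared : Cube → Cube → ℕ
shared u v = sum₃ λ i → coord u i ⋒ coord v i

shared-comm : ∀ u v → shared u v ≡ shared v u
shared-comm (a , b , c) (a′ , b′ , c′) = cong₂ _+_ (cong₂ _+_ (⋒-comm a a′) (⋒-comm b b′)) (⋒-comm c c′)

dist+shared : ∀ u v → dist u v + 2 * shared u v ≡ norm u + norm v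
dist+shared (a , b , c) (a′ , b′ , c′) = begin
  _ ≡⟨ lem (∣ a ℤ.- a′ ∣) (∣ b ℤ.- b′ ∣) (∣ c ℤ.- c′ ∣) (a ⋒ a′) (b ⋒ b′) (c ⋒ c′) ⟩
  (∣ a ℤ.- a′ ∣ + 2 * (a ⋒ a′)) + (∣ b ℤ.- b′ ∣ + 2 * (b ⋒ b′)) + (∣ c ℤ.- c′ ∣ + 2 * (c ⋒ c′))
    ≡⟨ cong₂ _+_ (cong₂ _+_ (∣-∣+⋒ a a′) (∣-∣+⋒ b b′)) (∣-∣+⋒ c c′) ⟩
  (∣ a ∣ + ∣ a′ ∣) + (∣ b ∣ + ∣ b′ ∣) + (∣ c ∣ + ∣ c′ ∣)
    ≡⟨ lem′ (∣ a ∣) (∣ a′ ∣) (∣ b ∣) (∣ b′ ∣) (∣ c ∣) (∣ c′ ∣) ⟩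
  _ ∎
  where
  open ≡-Reasoning
  lem : ∀ k l m x y z → k + l + m + 2 * (x + y + z) ≡ (k + 2 * x) + (l + 2 * y) + (m + 2 * z)
  lem = ℕ-Solver.solve-∀
  lem′ : ∀ k k′ l l′ m m′ → (k + k′) + (l + l′) + (m + m′) ≡ (k + l + m) + (k′ + l′ + m′)
  lem′ = ℕ-Solver.solve-∀

-- The parameter is q = p - 2, so the bound says that the distance exceeds 2p = 4 + 2q.
Far : ℕ → Cube → Cube → Set
Far q u v = 5 + 2 * q ≤ dist u v

record Shell (q : ℕ) (u : Cube) : Set where
  constructor shell
  field
    isCube : IsCube u
    level  : ℕ
    level≤5 : level ≤ 5
    norm≡  : norm u ≡ q + level
open Shell

-- Linear arithmetic: L ≤ R is a sum of hypotheses, s is the slack, and the equation is left to the ring solver.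
≤-by : ∀ {l r L R} s → L ≤ R → l + R + s ≡ r + L → l ≤ r
≤-by {l} {r} {L} {R} s L≤R e = +-cancelʳ-≤ R l r (begin
  l + R     ≤⟨ m≤m+n (l + R) s ⟩
  l + R + s ≡⟨ e ⟩
  r + L     ≤⟨ +-monoʳ-≤ r L≤R ⟩
  r + R     ∎)
  where open ≤-Reasoning

-- The norms add up to 2q plus the two levels; the 2q cancels against the one in `Far`, so only the
-- levels limit the overlap.
far⇒shared : ∀ {q u v} (s : Shell q u) (t : Shell q v) → Far q u v → 5 + 2 * shared u v ≤ level s + level t
far⇒shared {q} {u} {v} s t far = ≤-by 0
  (+-mono-≤ far (≤-reflexive (trans (dist+shared u v) (cong₂ _+_ (norm≡ s) (norm≡ t)))))
  (lem q (level s) (level t) (dist u v) (shared u v))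
  where
  lem : ∀ q k l d o → 5 + 2 * o + (d + ((q + k) + (q + l))) + 0 ≡ k + l + (5 + 2 * q + (d + 2 * o))
  lem = ℕ-Solver.solve-∀

-- Weights are scaled by 7. A vertex at level k has norm q + k, where q = p − 2: the levels 0, 1, 2 lie in the ball of
-- radius p and 3, 4, 5 outside it. The values come from an optimal dual solution of the fractional colouring problem.
φ : ℕ → ℕ
φ 0 = 5
φ 1 = 5
φ 2 = 4
φ 3 = 3
φ (suc (suc (suc (suc _)))) = 2

-- Here `k` is the level and `m` the smallest absolute value of a coordinate. The bound `φ` controls
-- pairs of far vertices; the second bound controls triples and bites only near the corners of the
-- hexagons, where `m` is small.
weightAt : ℕ → ℕ → ℕ
weightAt k m = φ k ⊓ (5 + m ⊓ 2 ∸ k)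

smallest : Cube → ℕ
smallest (a , b , c) = ∣ a ∣ ⊓ (∣ b ∣ ⊓ ∣ c ∣)

weight : ℕ → Cube → ℕ
weight q u = weightAt (norm u ∸ q) (smallest u)

weight-shell : ∀ {q u} (s : Shell q u) → weight q u ≡ weightAt (level s) (smallest u)
weight-shell {q} {u} s = cong (λ k → weightAt k (smallest u)) (trans (cong (_∸ q) (norm≡ s)) (m+n∸m≡n q (level s)))

weight≤φ : ∀ {q u} (s : Shell q u) → weight q u ≤ φ (level s)
weight≤φ s = ≤-trans (≤-reflexive (weight-shell s)) (m⊓n≤m _ _)

weight+level : ∀ {q u} (s : Shell q u) → weight q u + level s ≤ 5 + smallest u ⊓ 2
weight+level {q} {u} s = begin
  weight q u + level s                      ≤⟨ +-monoˡ-≤ (level s) (≤-trans (≤-reflexive (weight-shell s)) (m⊓n≤n (φ (level s)) _)) ⟩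
  5 + smallest u ⊓ 2 ∸ level s + level s    ≡⟨ m∸n+n≡m (≤-trans (level≤5 s) (m≤m+n 5 _)) ⟩
  5 + smallest u ⊓ 2                        ∎
  where open ≤-Reasoning

φ≤5 : ∀ k → φ k ≤ 5
φ≤5 0 = ≤-refl
φ≤5 1 = ≤-refl
φ≤5 2 = m≤m+n 4 1
φ≤5 3 = m≤m+n 3 2
φ≤5 (suc (suc (suc (suc _)))) = m≤m+n 2 3

-- This is the constraint on far pairs, whose levels add up to at least 5 by `far⇒shared`.
φ-pair : ∀ k l → 5 ≤ k + l → φ k + φ l ≤ 7
φ-pair 0 (suc (suc (suc (suc (suc _))))) _ = ≤-refl
φ-pair 1 (suc (suc (suc (suc _)))) _ = ≤-refl
φ-pair 2 3 _ = ≤-refl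
φ-pair 2 (suc (suc (suc (suc _)))) _ = n≤1+n 6
φ-pair 3 2 _ = ≤-refl
φ-pair 3 3 _ = n≤1+n 6
φ-pair 3 (suc (suc (suc (suc _)))) _ = m≤m+n 5 2
φ-pair (suc (suc (suc (suc _)))) l _ = +-monoʳ-≤ 2 (φ≤5 l)
φ-pair 0 0 ()
φ-pair 0 1 (s≤s ())
φ-pair 0 2 (s≤s (s≤s ()))
φ-pair 0 3 (s≤s (s≤s (s≤s ())))
φ-pair 0 4 (s≤s (s≤s (s≤s (s≤s ()))))
φ-pair 1 0 (s≤s ())
φ-pair 1 1 (s≤s (s≤s ()))
φ-pair 1 2 (s≤s (s≤s (s≤s ())))
φ-pair 1 3 (s≤s (s≤s (s≤s (s≤s ()))))
φ-pair 2 0 (s≤s (s≤s ()))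
φ-pair 2 1 (s≤s (s≤s (s≤s ())))
φ-pair 2 2 (s≤s (s≤s (s≤s (s≤s ()))))
φ-pair 3 0 (s≤s (s≤s (s≤s ())))
φ-pair 3 1 (s≤s (s≤s (s≤s (s≤s ()))))

-- Large coordinates of far vertices

≤-sum₃ : ∀ (x : Fin 3 → ℕ) i → x i ≤ sum₃ x
≤-sum₃ x zero             = ≤-trans (m≤m+n _ _) (m≤m+n _ _)
≤-sum₃ x (suc zero)       = ≤-trans (m≤n+m _ (x zero)) (m≤m+n _ _)
≤-sum₃ x (suc (suc zero)) = m≤n+m _ (x zero + x (suc zero))

-- Since one summand is 0, the larger of the other two is at least half of the sum.
large-part : ∀ (x : Fin 3 → ℕ) {t} → t ≤ 2 * sum₃ x → ∃[ j ] x j ≡ 0 → ∃[ i ] t ≤ 4 * x i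
large-part x {t} h (j , xj≡0) = pick j xj≡0
  where
  larger : ∀ {m n o} → o ≤ n → t ≤ 2 * (m + n + o) → m ≡ 0 → t ≤ 4 * n
  larger {n = n} {o} o≤n h refl = ≤-by 0 (+-mono-≤ h (*-monoʳ-≤ 2 o≤n)) (lem t n o)
    where lem : ∀ t n o → t + (2 * (n + o) + 2 * n) + 0 ≡ 4 * n + (t + 2 * o)
          lem = ℕ-Solver.solve-∀
  either : ∀ {j k l} → t ≤ 2 * (x j + x k + x l) → x j ≡ 0 → ∃[ i ] t ≤ 4 * x i
  either {j} {k} {l} h e with ≤-total (x l) (x k)
  ... | inj₁ l≤k = k , larger l≤k h e
  ... | inj₂ k≤l = l , larger k≤l (subst (λ z → t ≤ 2 * z) (+-comm-last (x j) (x k) (x l)) h) e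
    where +-comm-last : ∀ a b c → a + b + c ≡ a + c + b
          +-comm-last = ℕ-Solver.solve-∀
  pick : ∀ j → x j ≡ 0 → ∃[ i ] t ≤ 4 * x i
  pick zero             = either {zero} {suc zero} {suc (suc zero)} h
  pick (suc zero)       = either {suc zero} {zero} {suc (suc zero)} (subst (λ z → t ≤ 2 * (z + x (suc (suc zero)))) (+-comm (x zero) _) h)
  pick (suc (suc zero)) = either {suc (suc zero)} {zero} {suc zero}
    (subst (λ z → t ≤ 2 * z) (trans (+-comm _ (x (suc (suc zero)))) (sym (+-assoc (x (suc (suc zero))) _ _))) h)

positive negative : Cube → ℕ
positive u = sum₃ λ i → coord u i ⁺
negative u = sum₃ λ i → coord u i ⁻

positive+negative : ∀ u → positive u + negative u ≡ norm u
positive+negative (a , b , c) = trans (lem (a ⁺) (b ⁺) (c ⁺) (a ⁻) (b ⁻) (c ⁻))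
  (cong₂ _+_ (cong₂ _+_ (⁺+⁻ a) (⁺+⁻ b)) (⁺+⁻ c))
  where lem : ∀ a b c a′ b′ c′ → a + b + c + (a′ + b′ + c′) ≡ (a + a′) + (b + b′) + (c + c′)
        lem = ℕ-Solver.solve-∀

positive-negative : ∀ u → + positive u ≡ + negative u ℤ.+ total u
positive-negative (a , b , c) = trans (cong₂ ℤ._+_ (cong₂ ℤ._+_ (⁺-⁻ a) (⁺-⁻ b)) (⁺-⁻ c))
  (lem (+ (a ⁻)) (+ (b ⁻)) (+ (c ⁻)) a b c)
  where lem : ∀ x y z a b c → (x ℤ.+ a) ℤ.+ (y ℤ.+ b) ℤ.+ (z ℤ.+ c) ≡ x ℤ.+ y ℤ.+ z ℤ.+ (a ℤ.+ b ℤ.+ c)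
        lem = ℤ-Solver.solve-∀

positive-cube : ∀ u → IsCube u → positive u ≡ negative u ⊎ positive u ≡ suc (negative u)
positive-cube u (inj₁ t) = inj₁ (ℤ.+-injective (trans (positive-negative u) (trans (cong (ℤ._+_ (+ negative u)) t) (ℤ.+-identityʳ _))))
positive-cube u (inj₂ t) = inj₂ (ℤ.+-injective (trans (positive-negative u) (trans (cong (ℤ._+_ (+ negative u)) t) (cong +_ (+-comm (negative u) 1)))))

norm≤2positive : ∀ u → IsCube u → norm u ≤ 2 * positive u
norm≤2positive u p with positive-cube u p
... | inj₁ e = ≤-reflexive (trans (sym (positive+negative u)) (cong (λ z → positive u + z) (trans (sym e) (sym (+-identityʳ _)))))
... | inj₂ e = ≤-trans (≤-reflexive (sym (positive+negative u))) (+-monoʳ-≤ (positive u) (≤-trans (≤-trans (n≤1+n _) (≤-reflexive (sym e))) (m≤m+n (positive u) 0)))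

norm≤1+2negative : ∀ u → IsCube u → norm u ≤ 1 + 2 * negative u
norm≤1+2negative u p = ≤-trans (≤-reflexive (sym (positive+negative u))) (lem (positive-cube u p))
  where
  lem : positive u ≡ negative u ⊎ positive u ≡ suc (negative u) → positive u + negative u ≤ 1 + 2 * negative u
  lem (inj₁ e) rewrite e | +-identityʳ (negative u) = n≤1+n _
  lem (inj₂ e) rewrite e | +-identityʳ (negative u) = ≤-refl

some-⁺≡0 : ∀ u → 0 < negative u → ∃[ i ] coord u i ⁺ ≡ 0
some-⁺≡0 (-[1+ _ ] , _ , _) _ = zero , refl
some-⁺≡0 (+ _ , -[1+ _ ] , _) _ = suc zero , refl
some-⁺≡0 (+ _ , + _ , -[1+ _ ]) _ = suc (suc zero) , refl

some-⁻≡0 : ∀ u → 0 < positive u → ∃[ i ] coord u i ⁻ ≡ 0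
some-⁻≡0 (+ _ , _ , _) _ = zero , refl
some-⁻≡0 (-[1+ _ ] , + _ , _) _ = suc zero , refl
some-⁻≡0 (-[1+ _ ] , -[1+ _ ] , + _) _ = suc (suc zero) , refl

-- The total is 0 or 1, so the positive part is at least half of the norm, while the negative part
-- may miss half by one half; hence 7 against 6.
parts-large : ∀ {q u} → 7 ≤ q → (s : Shell q u) → 7 + level s ≤ 2 * positive u × 6 + level s ≤ 2 * negative u
parts-large {q} {u} 7≤q s = ≤-trans 7+k≤norm (norm≤2positive u (isCube s)) , s≤s⁻¹ (≤-trans 7+k≤norm (norm≤1+2negative u (isCube s)))
  where
  7+k≤norm : 7 + level s ≤ norm u
  7+k≤norm = ≤-trans (+-monoˡ-≤ (level s) 7≤q) (≤-reflexive (sym (norm≡ s)))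

-- The negative part is nonzero, so some coordinate has no positive part and `large-part` applies.
-- One unit is given away so that both signs share the bound `6 + level s`.
large-⁺ : ∀ {q u} → 7 ≤ q → (s : Shell q u) → ∃[ i ] 6 + level s ≤ 4 * coord u i ⁺
large-⁺ {q} {u} 7≤q s with parts-large 7≤q s
... | pos , neg = large-part (λ i → coord u i ⁺) (≤-trans (n≤1+n _) pos) (some-⁺≡0 u (*-cancelˡ-< 2 0 _ (≤-trans (m≤m+n 1 _) neg)))

large-⁻ : ∀ {q u} → 7 ≤ q → (s : Shell q u) → ∃[ i ] 6 + level s ≤ 4 * coord u i ⁻
large-⁻ {q} {u} 7≤q s with parts-large 7≤q s
... | pos , neg = large-part (λ i → coord u i ⁻) neg (some-⁻≡0 u (*-cancelˡ-< 2 0 _ (≤-trans (m≤m+n 1 _) pos)))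

-- Say x ≤ y, so that 4o ≥ 6 + k. Then 2(k + l) ≥ 10 + 4o ≥ 16 + k, that is k + 2l ≥ 16, whereas
-- levels up to 5 allow only 15.
shared-large : ∀ {x y o k l} → k ≤ 5 → l ≤ 5 → 6 + k ≤ 4 * x → 6 + l ≤ 4 * y → x ⊓ y ≤ o → ¬ (5 + 2 * o ≤ k + l)
shared-large {x} {y} {o} {k} {l} k≤5 l≤5 hx hy h far with ≤-total x y
... | inj₁ x≤y rewrite m≤n⇒m⊓n≡m x≤y = 1+n≰n {5} (≤-by 0 (+-mono-≤ (+-mono-≤ hx (*-monoʳ-≤ 4 h)) (+-mono-≤ (*-monoʳ-≤ 2 far) (+-mono-≤ k≤5 (*-monoʳ-≤ 2 l≤5)))) (lem x o k l))
  where lem : ∀ x o k l → 6 + ((4 * x + 4 * o) + (2 * (k + l) + (5 + 2 * 5))) + 0 ≡ 5 + ((6 + k + 4 * x) + (2 * (5 + 2 * o) + (k + 2 * l)))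
        lem = ℕ-Solver.solve-∀
... | inj₂ y≤x rewrite m≥n⇒m⊓n≡n y≤x = 1+n≰n {5} (≤-by 0 (+-mono-≤ (+-mono-≤ hy (*-monoʳ-≤ 4 h)) (+-mono-≤ (*-monoʳ-≤ 2 far) (+-mono-≤ l≤5 (*-monoʳ-≤ 2 k≤5)))) (lem y o k l))
  where lem : ∀ x o k l → 6 + ((4 * x + 4 * o) + (2 * (k + l) + (5 + 2 * 5))) + 0 ≡ 5 + ((6 + l + 4 * x) + (2 * (5 + 2 * o) + (l + 2 * k)))
        lem = ℕ-Solver.solve-∀

large⇒2≤ : ∀ {k x} → 6 + k ≤ 4 * x → 2 ≤ x
large⇒2≤ {k} {x} h = *-cancelˡ-< 4 1 x (≤-trans (m≤m+n 5 (1 + k)) h)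

smallest≤ : ∀ u i → smallest u ≤ ∣ coord u i ∣
smallest≤ (a , b , c) zero             = m⊓n≤m _ _
smallest≤ (a , b , c) (suc zero)       = ≤-trans (m⊓n≤n _ _) (m⊓n≤m _ _)
smallest≤ (a , b , c) (suc (suc zero)) = ≤-trans (m⊓n≤n _ _) (m⊓n≤n _ _)

-- Whatever the sign of `x`, one of `y` and `z` has the same sign and absolute value at least 2.
⋒-third : ∀ x y z → 2 ≤ y ⁺ → 2 ≤ z ⁻ → ∣ x ∣ ⊓ 2 ≤ x ⋒ y + x ⋒ z
⋒-third (+ n)    y z 2≤y 2≤z = ≤-trans (⊓-monoʳ-≤ n 2≤y) (≤-trans (m≤m+n _ _) (m≤m+n _ _))
⋒-third -[1+ n ] y z 2≤y 2≤z = ≤-trans (⊓-monoʳ-≤ (suc n) 2≤z) (m≤n+m _ (-[1+ n ] ⋒ y))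

third : ∀ u {v w} i → 2 ≤ coord v i ⁺ → 2 ≤ coord w i ⁻ → smallest u ⊓ 2 ≤ coord u i ⋒ coord v i + coord u i ⋒ coord w i
third u i 2≤v 2≤w = ≤-trans (⊓-monoˡ-≤ 2 (smallest≤ u i)) (⋒-third (coord u i) _ _ 2≤v 2≤w)

arrangements : List (Fin 3 × Fin 3 × Fin 3)
arrangements = (𝟘 , 𝟙 , 𝟚) ∷ (𝟘 , 𝟚 , 𝟙) ∷ (𝟙 , 𝟘 , 𝟚) ∷ (𝟙 , 𝟚 , 𝟘) ∷ (𝟚 , 𝟘 , 𝟙) ∷ (𝟚 , 𝟙 , 𝟘) ∷ []
  where
  𝟘 𝟙 𝟚 : Fin 3
  𝟘 = zero
  𝟙 = suc zero
  𝟚 = suc (suc zero)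

open DecMembership (≡-dec (Fin._≟_ {3}) (≡-dec (Fin._≟_ {3}) (Fin._≟_ {3}))) using () renaming (_∈?_ to _∈₃?_)

all₃? : ∀ {p} {P : Pred (Fin 3) p} → Decidable P → Dec (∀ i → P i)
all₃? = Fin.all?

distinct⇒arrangement : ∀ i j l → i ≢ j → j ≢ l → i ≢ l → (i , j , l) ∈ arrangements
distinct⇒arrangement = toWitness {a? = all₃? λ i → all₃? λ j → all₃? λ l →
  ¬? (i Fin.≟ j) →-dec ¬? (j Fin.≟ l) →-dec ¬? (i Fin.≟ l) →-dec (i , j , l) ∈₃? arrangements} _

sum₃-arrangement : ∀ (x : Fin 3 → ℕ) → All (λ (i , j , l) → x i + x j + x l ≡ sum₃ x) arrangements
sum₃-arrangement x =
  refl ∷ xzy a b c ∷ yxz a b c ∷ zxy a b c ∷ yzx a b c ∷ zyx a b c ∷ []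
  where
  a = x zero
  b = x (suc zero)
  c = x (suc (suc zero))
  xzy : ∀ a b c → a + c + b ≡ a + b + c
  xzy = ℕ-Solver.solve-∀
  yxz : ∀ a b c → b + a + c ≡ a + b + c
  yxz = ℕ-Solver.solve-∀
  zxy : ∀ a b c → b + c + a ≡ a + b + c
  zxy = ℕ-Solver.solve-∀
  yzx : ∀ a b c → c + a + b ≡ a + b + c
  yzx = ℕ-Solver.solve-∀
  zyx : ∀ a b c → c + b + a ≡ a + b + c
  zyx = ℕ-Solver.solve-∀

-- The six large parts of u, v, w occupy each of the six signed axes once, so the remaining coordinate of each of them
-- meets a large part of the same sign in one of the other two.
triangle : ∀ {u v w} i j l → i ≢ j → j ≢ l → i ≢ l →
  2 ≤ coord u i ⁺ → 2 ≤ coord u j ⁻ → 2 ≤ coord v j ⁺ → 2 ≤ coord v l ⁻ → 2 ≤ coord w l ⁺ → 2 ≤ coord w i ⁻ →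
  smallest u ⊓ 2 + smallest v ⊓ 2 + smallest w ⊓ 2 ≤ shared u v + shared u w + shared v w
triangle {u} {v} {w} i j l i≢j j≢l i≢l ui uj vj vl wl wi = begin
  smallest u ⊓ 2 + smallest v ⊓ 2 + smallest w ⊓ 2
    ≤⟨ +-mono-≤ (+-mono-≤ (third u l wl vl) (third v i ui wi)) (third w j vj uj) ⟩
  (u · l ⋒ w · l + u · l ⋒ v · l) + (v · i ⋒ u · i + v · i ⋒ w · i) + (w · j ⋒ v · j + w · j ⋒ u · j)
    ≡⟨ cong₂ _+_ (cong (λ z → (u · l ⋒ w · l + u · l ⋒ v · l) + (z + v · i ⋒ w · i)) (⋒-comm (v · i) (u · i))) (cong₂ _+_ (⋒-comm (w · j) (v · j)) (⋒-comm (w · j) (u · j))) ⟩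
  (u · l ⋒ w · l + u · l ⋒ v · l) + (u · i ⋒ v · i + v · i ⋒ w · i) + (v · j ⋒ w · j + u · j ⋒ w · j)
    ≤⟨ m≤m+n _ (u · j ⋒ v · j + u · i ⋒ w · i + v · l ⋒ w · l) ⟩
  _ ≡⟨ lem (u · l ⋒ w · l) (u · l ⋒ v · l) (u · i ⋒ v · i) (v · i ⋒ w · i) (v · j ⋒ w · j) (u · j ⋒ w · j) (u · j ⋒ v · j) (u · i ⋒ w · i) (v · l ⋒ w · l) ⟩
  (u · i ⋒ v · i + u · j ⋒ v · j + u · l ⋒ v · l) + (u · i ⋒ w · i + u · j ⋒ w · j + u · l ⋒ w · l) + (v · i ⋒ w · i + v · j ⋒ w · j + v · l ⋒ w · l)
    ≡⟨ cong₂ _+_ (cong₂ _+_ (total-shared u v) (total-shared u w)) (total-shared v w) ⟩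
  shared u v + shared u w + shared v w ∎
  where
  open ≤-Reasoning
  infix 10 _·_
  _·_ = coord
  total-shared : ∀ u v → u · i ⋒ v · i + u · j ⋒ v · j + u · l ⋒ v · l ≡ shared u v
  total-shared u v = All.lookup (sum₃-arrangement (λ i → u · i ⋒ v · i)) (distinct⇒arrangement i j l i≢j j≢l i≢l)
  lem : ∀ a b c d e f g h k → (a + b) + (c + d) + (e + f) + (g + h + k) ≡ (c + g + b) + (h + f + a) + (d + e + k)
  lem = ℕ-Solver.solve-∀

-- Let W, K, S, O be the sums of the weights, levels, truncated smallest coordinates and overlaps.
-- Then W + K ≤ 15 + S by `weight+level`, 15 + 2O ≤ 2K by `far⇒shared`, and S ≤ O by hypothesis.
-- Hence 2W ≤ 15.
weight-triangle : ∀ {q u v w} → Shell q u → Shell q v → Shell q w → Far q u v → Far q u w → Far q v w →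
  smallest u ⊓ 2 + smallest v ⊓ 2 + smallest w ⊓ 2 ≤ shared u v + shared u w + shared v w →
  weight q u + weight q v + weight q w ≤ 7
weight-triangle {q} {u} {v} {w} s t r uv uw vw h = s≤s⁻¹ (*-cancelˡ-< 2 _ 8 (s≤s (≤-by 0
  (+-mono-≤ (*-monoʳ-≤ 2 weights) (+-mono-≤ (*-monoʳ-≤ 2 h) levels))
  (lem (weight q u + weight q v + weight q w) (level s + level t + level r) (smallest u ⊓ 2 + smallest v ⊓ 2 + smallest w ⊓ 2) (shared u v + shared u w + shared v w)))))
  where
  interchange : ∀ a b c k l m → (a + k) + (b + l) + (c + m) ≡ (a + b + c) + (k + l + m)
  interchange = ℕ-Solver.solve-∀
  weights : (weight q u + weight q v + weight q w) + (level s + level t + level r) ≤ 15 + (smallest u ⊓ 2 + smallest v ⊓ 2 + smallest w ⊓ 2)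
  weights = subst₂ _≤_ (interchange (weight q u) (weight q v) (weight q w) _ _ _) (interchange 5 5 5 _ _ _)
    (+-mono-≤ (+-mono-≤ (weight+level s) (weight+level t)) (weight+level r))
  levels : 15 + 2 * (shared u v + shared u w + shared v w) ≤ 2 * (level s + level t + level r)
  levels = subst₂ _≤_ (expand (shared u v) (shared u w) (shared v w)) (collect (level s) (level t) (level r))
    (+-mono-≤ (+-mono-≤ (far⇒shared s t uv) (far⇒shared s r uw)) (far⇒shared t r vw))
    where
    expand : ∀ x y z → (5 + 2 * x) + (5 + 2 * y) + (5 + 2 * z) ≡ 15 + 2 * (x + y + z)
    expand = ℕ-Solver.solve-∀
    collect : ∀ k l m → (k + l) + (k + m) + (l + m) ≡ 2 * (k + l + m)
    collect = ℕ-Solver.solve-∀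
  lem : ∀ w k x o → 2 * w + (2 * (15 + x) + (2 * o + 2 * k)) + 0 ≡ 15 + (2 * (w + k) + (2 * x + (15 + 2 * o)))
  lem = ℕ-Solver.solve-∀

pigeonhole₄ : ∀ (i j k l : Fin 3) → (i ≡ j ⊎ i ≡ k ⊎ i ≡ l) ⊎ (j ≡ k ⊎ j ≡ l) ⊎ k ≡ l
pigeonhole₄ = toWitness {a? = all₃? λ i → all₃? λ j → all₃? λ k → all₃? λ l →
  (i Fin.≟ j ⊎-dec i Fin.≟ k ⊎-dec i Fin.≟ l) ⊎-dec (j Fin.≟ k ⊎-dec j Fin.≟ l) ⊎-dec k Fin.≟ l} _

-- The unprimed indices will be the axes of the large positive parts of three vertices, the primed
-- ones those of the negative parts. Two permutations of three axes that disagree everywhere differ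
-- by one of the two 3-cycles. Each inequality follows its last index, so that the check discards
-- cases early.
two-cycles : ∀ (i j : Fin 3) → i ≢ j → ∀ k → i ≢ k → j ≢ k → ∀ i′ → i ≢ i′ → ∀ j′ → j ≢ j′ → i′ ≢ j′ →
  ∀ k′ → k ≢ k′ → i′ ≢ k′ → j′ ≢ k′ → (i′ ≡ j × j′ ≡ k × k′ ≡ i) ⊎ (i′ ≡ k × k′ ≡ j × j′ ≡ i)
two-cycles = toWitness {a? = all₃? λ i → all₃? λ j → ¬? (i Fin.≟ j) →-dec all₃? λ k → ¬? (i Fin.≟ k) →-dec ¬? (j Fin.≟ k) →-dec
  all₃? λ i′ → ¬? (i Fin.≟ i′) →-dec all₃? λ j′ → ¬? (j Fin.≟ j′) →-dec ¬? (i′ Fin.≟ j′) →-dec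
  all₃? λ k′ → ¬? (k Fin.≟ k′) →-dec ¬? (i′ Fin.≟ k′) →-dec ¬? (j′ Fin.≟ k′) →-dec
  ((i′ Fin.≟ j ×-dec j′ Fin.≟ k ×-dec k′ Fin.≟ i) ⊎-dec (i′ Fin.≟ k ×-dec k′ Fin.≟ j ×-dec j′ Fin.≟ i))} _

⁺⁻-exclusive : ∀ i → 2 ≤ i ⁺ → ¬ (2 ≤ i ⁻)
⁺⁻-exclusive (+ _) _ ()

FarBounded : ℕ → (Cube → ℕ) → Set
FarBounded q W = ∀ us → All (Shell q) us → AllPairs (Far q) us → sum (map W us) ≤ 7

module _ {q} (7≤q : 7 ≤ q) where

  -- On a common axis the two large positive parts would overlap too much for a far pair, by
  -- `shared-large`.
  separated⁺ : ∀ {u v} (s : Shell q u) (t : Shell q v) → Far q u v → proj₁ (large-⁺ 7≤q s) ≢ proj₁ (large-⁺ 7≤q t)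
  separated⁺ {u} {v} s t far e with large-⁺ 7≤q s | large-⁺ 7≤q t
  ... | i , hu | j , hv with refl ← e = shared-large {coord u i ⁺} {coord v i ⁺} (level≤5 s) (level≤5 t) hu hv
    (≤-trans (m≤m+n _ (coord u i ⁻ ⊓ coord v i ⁻)) (≤-sum₃ (λ i → coord u i ⋒ coord v i) i)) (far⇒shared s t far)

  separated⁻ : ∀ {u v} (s : Shell q u) (t : Shell q v) → Far q u v → proj₁ (large-⁻ 7≤q s) ≢ proj₁ (large-⁻ 7≤q t)
  separated⁻ {u} {v} s t far e with large-⁻ 7≤q s | large-⁻ 7≤q t
  ... | i , hu | j , hv with refl ← e = shared-large {coord u i ⁻} {coord v i ⁻} (level≤5 s) (level≤5 t) hu hv
    (≤-trans (m≤n+m _ (coord u i ⁺ ⊓ coord v i ⁺)) (≤-sum₃ (λ i → coord u i ⋒ coord v i) i)) (far⇒shared s t far)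

  2≤⁺ : ∀ {u} (s : Shell q u) → 2 ≤ coord u (proj₁ (large-⁺ 7≤q s)) ⁺
  2≤⁺ s = large⇒2≤ (proj₂ (large-⁺ 7≤q s))

  2≤⁻ : ∀ {u} (s : Shell q u) → 2 ≤ coord u (proj₁ (large-⁻ 7≤q s)) ⁻
  2≤⁻ s = large⇒2≤ (proj₂ (large-⁻ 7≤q s))

  separated± : ∀ {u} (s : Shell q u) → proj₁ (large-⁺ 7≤q s) ≢ proj₁ (large-⁻ 7≤q s)
  separated± {u} s e = ⁺⁻-exclusive _ (2≤⁺ s) (subst (λ i → 2 ≤ coord u i ⁻) (sym e) (2≤⁻ s))

  -- By the length of the list: levels alone settle pairs, the arrangement of the large parts on the
  -- axes settles triples, and four vertices would need four axes for their large positive parts.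
  weight-far : FarBounded q (weight q)
  weight-far [] _ _ = z≤n
  weight-far (u ∷ []) (s ∷ []) _ = ≤-trans (+-monoˡ-≤ 0 (≤-trans (weight≤φ s) (φ≤5 (level s)))) (m≤m+n 5 2)
  weight-far (u ∷ v ∷ []) (s ∷ t ∷ []) ((uv ∷ []) ∷ _) =
    ≤-trans (+-mono-≤ (weight≤φ s) (≤-trans (≤-reflexive (+-identityʳ _)) (weight≤φ t)))
            (φ-pair (level s) (level t) (≤-trans (m≤m+n 5 _) (far⇒shared s t uv)))
  weight-far (u ∷ v ∷ w ∷ []) (s ∷ t ∷ r ∷ []) ((uv ∷ uw ∷ []) ∷ (vw ∷ []) ∷ _) = ≤-trans (≤-reflexive reassoc)
    (weight-triangle s t r uv uw vw (cycle (two-cycles i j i≢j k i≢k j≢k i′ (separated± s) j′ (separated± t) (separated⁻ s t uv)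
      k′ (separated± r) (separated⁻ s r uw) (separated⁻ t r vw))))
    where
    reassoc : weight q u + (weight q v + (weight q w + 0)) ≡ weight q u + weight q v + weight q w
    reassoc = trans (cong (λ z → weight q u + (weight q v + z)) (+-identityʳ _)) (sym (+-assoc (weight q u) _ _))
    i = proj₁ (large-⁺ 7≤q s)
    j = proj₁ (large-⁺ 7≤q t)
    k = proj₁ (large-⁺ 7≤q r)
    i′ = proj₁ (large-⁻ 7≤q s)
    j′ = proj₁ (large-⁻ 7≤q t)
    k′ = proj₁ (large-⁻ 7≤q r)
    i≢j : i ≢ j
    i≢j = separated⁺ s t uv
    i≢k : i ≢ k
    i≢k = separated⁺ s r uw
    j≢k : j ≢ k
    j≢k = separated⁺ t r vw
    ui′ = 2≤⁻ s
    vj′ = 2≤⁻ t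
    wk′ = 2≤⁻ r
    swap : ∀ {a b c} → a + b + c ≡ a + c + b
    swap {a} {b} {c} = lem a b c
      where lem : ∀ a b c → a + b + c ≡ a + c + b
            lem = ℕ-Solver.solve-∀
    cycle : (i′ ≡ j × j′ ≡ k × k′ ≡ i) ⊎ (i′ ≡ k × k′ ≡ j × j′ ≡ i) →
      smallest u ⊓ 2 + smallest v ⊓ 2 + smallest w ⊓ 2 ≤ shared u v + shared u w + shared v w
    cycle (inj₁ (e , f , g)) = triangle {u} {v} {w} i j k i≢j j≢k i≢k (2≤⁺ s) (subst (λ i → 2 ≤ coord u i ⁻) e ui′)
      (2≤⁺ t) (subst (λ i → 2 ≤ coord v i ⁻) f vj′) (2≤⁺ r) (subst (λ i → 2 ≤ coord w i ⁻) g wk′)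
    -- The opposite cyclic pattern becomes the first one when `v` and `w` trade places.
    cycle (inj₂ (e , f , g)) = subst₂ _≤_ (swap {smallest u ⊓ 2}) (cong₂ _+_ (+-comm (shared u w) (shared u v)) (shared-comm w v))
      (triangle {u} {w} {v} i k j i≢k (≢-sym j≢k) i≢j (2≤⁺ s) (subst (λ i → 2 ≤ coord u i ⁻) e ui′)
      (2≤⁺ r) (subst (λ i → 2 ≤ coord w i ⁻) f wk′) (2≤⁺ t) (subst (λ i → 2 ≤ coord v i ⁻) g vj′))
  weight-far (u ∷ v ∷ w ∷ z ∷ _) (s ∷ t ∷ r ∷ p ∷ _) ((uv ∷ uw ∷ uz ∷ _) ∷ (vw ∷ vz ∷ _) ∷ (wz ∷ _) ∷ _) =
    contradiction (pigeonhole₄ (proj₁ (large-⁺ 7≤q s)) (proj₁ (large-⁺ 7≤q t)) (proj₁ (large-⁺ 7≤q r)) (proj₁ (large-⁺ 7≤q p)))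
      λ { (inj₁ (inj₁ e))        → separated⁺ s t uv e
        ; (inj₁ (inj₂ (inj₁ e))) → separated⁺ s r uw e
        ; (inj₁ (inj₂ (inj₂ e))) → separated⁺ s p uz e
        ; (inj₂ (inj₁ (inj₁ e))) → separated⁺ t r vw e
        ; (inj₂ (inj₁ (inj₂ e))) → separated⁺ t p vz e
        ; (inj₂ (inj₂ e))        → separated⁺ r p wz e }

-- Sums over colour classes

module _ {a} {A : Set a} (W : A → ℕ) where

  sum-filter-split : ∀ {p} {P : Pred A p} (P? : Decidable P) xs →
    sum (map W xs) ≡ sum (map W (filter P? xs)) + sum (map W (filter (λ x → ¬? (P? x)) xs))
  sum-filter-split P? []       = refl
  sum-filter-split P? (x ∷ xs) with P? x
  ... | yes _ = trans (cong (λ z → W x + z) (sum-filter-split P? xs)) (sym (+-assoc (W x) _ _))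
  ... | no  _ = begin
    W x + sum (map W xs) ≡⟨ cong (λ z → W x + z) (sum-filter-split P? xs) ⟩
    W x + (s + t)        ≡⟨ +-assoc (W x) s t ⟨
    (W x + s) + t        ≡⟨ cong (_+ t) (+-comm (W x) s) ⟩
    (s + W x) + t        ≡⟨ +-assoc s (W x) t ⟩
    s + (W x + t)        ∎
    where
    open ≡-Reasoning
    s = sum (map W (filter P? xs))
    t = sum (map W (filter (λ x → ¬? (P? x)) xs))

  -- This carries a cap on a class over from the whole list to what is left after other classes are
  -- removed.
  sum-filter-filter : ∀ {p q} {P : Pred A p} {Q : Pred A q} (P? : Decidable P) (Q? : Decidable Q) xs →
    sum (map W (filter P? (filter Q? xs))) ≤ sum (map W (filter P? xs))
  sum-filter-filter P? Q? [] = z≤n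
  sum-filter-filter P? Q? (x ∷ xs) with Q? x
  sum-filter-filter P? Q? (x ∷ xs) | yes _ with P? x
  ... | yes _ = +-monoʳ-≤ (W x) (sum-filter-filter P? Q? xs)
  ... | no  _ = sum-filter-filter P? Q? xs
  sum-filter-filter P? Q? (x ∷ xs) | no  _ with P? x
  ... | yes _ = ≤-trans (sum-filter-filter P? Q? xs) (m≤n+m _ (W x))
  ... | no  _ = sum-filter-filter P? Q? xs

  module _ {c} {C : Set c} (_≟_ : DecidableEquality C) (f : A → C) where

    class : C → List A → List A
    class c = filter (λ x → f x ≟ c)

    -- The classes are removed one after the other; coverage by the caps guarantees that nothing is
    -- left at the end. A repeated colour would meet an empty class the second time.
    sum-by-class : ∀ (caps : List (C × ℕ)) xs → All (λ x → f x ∈ map proj₁ caps) xs →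
      All (λ (c , n) → sum (map W (class c xs)) ≤ n) caps → sum (map W xs) ≤ sum (map proj₂ caps)
    sum-by-class []               []      _        _        = z≤n
    sum-by-class []               (_ ∷ _) (() ∷ _) _
    sum-by-class ((c , n) ∷ caps) xs      covered  (h ∷ hs) = begin
      sum (map W xs)                               ≡⟨ sum-filter-split (λ x → f x ≟ c) xs ⟩
      sum (map W (class c xs)) + sum (map W rest)  ≤⟨ +-mono-≤ h (sum-by-class caps rest covered′ hs′) ⟩
      n + sum (map proj₂ caps)                     ∎
      where
      open ≤-Reasoning
      rest = filter (λ x → ¬? (f x ≟ c)) xs
      other : ∀ {x} → f x ≢ c × f x ∈ c ∷ map proj₁ caps → f x ∈ map proj₁ caps
      other (≢c , here ≡c) = contradiction ≡c ≢c
      other (_  , there h) = h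
      covered′ : All (λ x → f x ∈ map proj₁ caps) rest
      covered′ = All.zipWith other (All.all-filter (λ x → ¬? (f x ≟ c)) xs , All.filter⁺ (λ x → ¬? (f x ≟ c)) covered)
      hs′ : All (λ (c , n) → sum (map W (class c rest)) ≤ n) caps
      hs′ = All.map (≤-trans (sum-filter-filter _ _ xs)) hs

-- Spheres

rotate : Fin 3 → Cube → Cube
rotate zero             u           = u
rotate (suc zero)       (a , b , c) = b , c , a
rotate (suc (suc zero)) (a , b , c) = c , a , b

total-rotate : ∀ r u → total (rotate r u) ≡ total u
total-rotate zero             u           = refl
total-rotate (suc zero)       (a , b , c) = lem a b c
  where lem : ∀ a b c → b ℤ.+ c ℤ.+ a ≡ a ℤ.+ b ℤ.+ c
        lem = ℤ-Solver.solve-∀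
total-rotate (suc (suc zero)) (a , b , c) = lem a b c
  where lem : ∀ a b c → c ℤ.+ a ℤ.+ b ≡ a ℤ.+ b ℤ.+ c
        lem = ℤ-Solver.solve-∀

norm-rotate : ∀ r u → norm (rotate r u) ≡ norm u
norm-rotate zero             u           = refl
norm-rotate (suc zero)       (a , b , c) = lem (∣ a ∣) (∣ b ∣) (∣ c ∣)
  where lem : ∀ a b c → b + c + a ≡ a + b + c
        lem = ℕ-Solver.solve-∀
norm-rotate (suc (suc zero)) (a , b , c) = lem (∣ a ∣) (∣ b ∣) (∣ c ∣)
  where lem : ∀ a b c → c + a + b ≡ a + b + c
        lem = ℕ-Solver.solve-∀

rotate-injective : ∀ r {u v} → rotate r u ≡ rotate r v → u ≡ v
rotate-injective zero             refl = refl
rotate-injective (suc zero)       refl = refl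
rotate-injective (suc (suc zero)) refl = refl

≤-smallest-rotate : ∀ r {a b c m} → m ≤ ∣ a ∣ → m ≤ ∣ b ∣ → m ≤ ∣ c ∣ → m ≤ smallest (rotate r (a , b , c))
≤-smallest-rotate zero             x y z = ⊓-glb x (⊓-glb y z)
≤-smallest-rotate (suc zero)       x y z = ⊓-glb y (⊓-glb z x)
≤-smallest-rotate (suc (suc zero)) x y z = ⊓-glb z (⊓-glb x y)

-- For i < B the first is (A, -i, i - B), and for i < A the second is (-B, i, A - i): one part of
-- the norm sits on one axis, the other is split over two. The last coordinate is written with a
-- successor so that its sign is visible.
outward inward : ℕ → ℕ → ℕ → Cube
outward A B i = + A , ℤ.- + i , -[1+ B ∸ suc i ]
inward  A B i = ℤ.- + B , + i , + suc (A ∸ suc i)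

-- The sphere of radius n is a hexagon. (r , true) is the side on which one coordinate is positive, (r , false) the one
-- on which one coordinate is negative; each side contains exactly one of its two end points.
Side : Set
Side = Fin 3 × Bool

sides : List Side
sides = (zero , true) ∷ (suc zero , true) ∷ (suc (suc zero) , true) ∷
        (zero , false) ∷ (suc zero , false) ∷ (suc (suc zero) , false) ∷ []

sideLength : ℕ → Bool → ℕ
sideLength n true  = ⌊ n /2⌋
sideLength n false = ⌈ n /2⌉

sidePoint : ℕ → Side → ℕ → Cube
sidePoint n (r , true)  i = rotate r (outward ⌈ n /2⌉ ⌊ n /2⌋ i)
sidePoint n (r , false) i = rotate r (inward ⌈ n /2⌉ ⌊ n /2⌋ i)

side : ℕ → Side → List Cube
side n s = applyUpTo (sidePoint n s) (sideLength n (proj₂ s))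

sphere : ℕ → List Cube
sphere n = concatMap (side n) sides

-- The last clause is never met on a sphere of radius at least 2.
sideOf : Cube → Side
sideOf (+ _      , -[1+ _ ] , -[1+ _ ]) = zero , true
sideOf (+ _      , + zero   , -[1+ _ ]) = zero , true
sideOf (-[1+ _ ] , -[1+ _ ] , + _     ) = suc zero , true
sideOf (+ zero   , -[1+ _ ] , + _     ) = suc zero , true
sideOf (-[1+ _ ] , + _      , -[1+ _ ]) = suc (suc zero) , true
sideOf (-[1+ _ ] , + _      , + zero  ) = suc (suc zero) , true
sideOf (-[1+ _ ] , + _      , + suc _ ) = zero , false
sideOf (+ _      , + suc _  , -[1+ _ ]) = suc zero , false
sideOf (+ suc _  , -[1+ _ ] , + _     ) = suc (suc zero) , false
sideOf _                                = zero , true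

sideOf-outward : ∀ r A B i → sideOf (rotate r (outward A B i)) ≡ (r , true)
sideOf-outward zero             A B zero    = refl
sideOf-outward (suc zero)       A B zero    = refl
sideOf-outward (suc (suc zero)) A B zero    = refl
sideOf-outward zero             A B (suc i) = refl
sideOf-outward (suc zero)       A B (suc i) = refl
sideOf-outward (suc (suc zero)) A B (suc i) = refl

-- The successor keeps the coordinate -B negative, which is why spheres are taken of radius at least
-- 2.
sideOf-inward : ∀ r A B i → sideOf (rotate r (inward A (suc B) i)) ≡ (r , false)
sideOf-inward zero             A B i = refl
sideOf-inward (suc zero)       A B i = refl
sideOf-inward (suc (suc zero)) A B i = refl

⌈n/2⌉-cases : ∀ n → ⌈ n /2⌉ ≡ ⌊ n /2⌋ ⊎ ⌈ n /2⌉ ≡ suc ⌊ n /2⌋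
⌈n/2⌉-cases zero    = inj₁ refl
⌈n/2⌉-cases (suc zero) = inj₂ refl
⌈n/2⌉-cases (suc (suc n)) with ⌈n/2⌉-cases n
... | inj₁ e = inj₁ (cong suc e)
... | inj₂ e = inj₂ (cong suc e)

difference-isCube : ∀ u {A B} → total u ≡ + A ℤ.- + B → A ≡ B ⊎ A ≡ suc B → IsCube u
difference-isCube u {A} e (inj₁ refl) = inj₁ (trans e (ℤ.+-inverseʳ (+ A)))
difference-isCube u {_} {B} e (inj₂ refl) = inj₂ (trans e (lem (+ B)))
  where lem : ∀ b → (1ℤ ℤ.+ b) ℤ.- b ≡ 1ℤ
        lem = ℤ-Solver.solve-∀

total-outward : ∀ A B {i} → i < B → total (outward A B i) ≡ + A ℤ.- + B
total-outward A B {i} i<B = trans (lem (+ A) (+ i) (+ (B ∸ suc i)))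
  (cong (λ z → + A ℤ.- + z) (trans (+-suc i _) (m+[n∸m]≡n i<B)))
  where lem : ∀ a i j → a ℤ.+ ℤ.- i ℤ.+ ℤ.- (1ℤ ℤ.+ j) ≡ a ℤ.- (i ℤ.+ (1ℤ ℤ.+ j))
        lem = ℤ-Solver.solve-∀

total-inward : ∀ A B {i} → i < A → total (inward A B i) ≡ + A ℤ.- + B
total-inward A B {i} i<A = trans (lem (+ B) (+ i) (+ (A ∸ suc i)))
  (cong (λ z → + z ℤ.- + B) (trans (+-suc i _) (m+[n∸m]≡n i<A)))
  where lem : ∀ b i j → ℤ.- b ℤ.+ i ℤ.+ (1ℤ ℤ.+ j) ≡ (i ℤ.+ (1ℤ ℤ.+ j)) ℤ.- b
        lem = ℤ-Solver.solve-∀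

norm-outward : ∀ A B {i} → i < B → norm (outward A B i) ≡ A + B
norm-outward A B {i} i<B rewrite ℤ.∣-i∣≡∣i∣ (+ i) =
  trans (+-assoc A i _) (cong (λ z → A + z) (trans (+-suc i _) (m+[n∸m]≡n i<B)))

norm-inward : ∀ A B {i} → i < A → norm (inward A B i) ≡ A + B
norm-inward A B {i} i<A rewrite ℤ.∣-i∣≡∣i∣ (+ B) =
  trans (+-assoc B i _) (trans (cong (λ z → B + z) (trans (+-suc i _) (m+[n∸m]≡n i<A))) (+-comm B A))

⌈n/2⌉+⌊n/2⌋≡n : ∀ n → ⌈ n /2⌉ + ⌊ n /2⌋ ≡ n
⌈n/2⌉+⌊n/2⌋≡n n = trans (+-comm ⌈ n /2⌉ ⌊ n /2⌋) (⌊n/2⌋+⌈n/2⌉≡n n)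

sidePoint-isCube : ∀ n s {i} → i < sideLength n (proj₂ s) → IsCube (sidePoint n s i)
sidePoint-isCube n (r , true)  {i} i< = difference-isCube (sidePoint n (r , true) i) (trans (total-rotate r _) (total-outward ⌈ n /2⌉ ⌊ n /2⌋ i<)) (⌈n/2⌉-cases n)
sidePoint-isCube n (r , false) {i} i< = difference-isCube (sidePoint n (r , false) i) (trans (total-rotate r _) (total-inward ⌈ n /2⌉ ⌊ n /2⌋ i<)) (⌈n/2⌉-cases n)

norm-sidePoint : ∀ n s {i} → i < sideLength n (proj₂ s) → norm (sidePoint n s i) ≡ n
norm-sidePoint n (r , true)  i< = trans (norm-rotate r _) (trans (norm-outward ⌈ n /2⌉ ⌊ n /2⌋ i<) (⌈n/2⌉+⌊n/2⌋≡n n))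
norm-sidePoint n (r , false) i< = trans (norm-rotate r _) (trans (norm-inward ⌈ n /2⌉ ⌊ n /2⌋ i<) (⌈n/2⌉+⌊n/2⌋≡n n))

sideOf-sidePoint : ∀ n s i → sideOf (sidePoint (2 + n) s i) ≡ s
sideOf-sidePoint n (r , true)  i = sideOf-outward r ⌈ 2 + n /2⌉ ⌊ 2 + n /2⌋ i
sideOf-sidePoint n (r , false) i = sideOf-inward r ⌈ 2 + n /2⌉ ⌊ n /2⌋ i

sidePoint-injective : ∀ n s {i j} → sidePoint n s i ≡ sidePoint n s j → i ≡ j
sidePoint-injective n (r , true) {i} {j} e =
  trans (sym (ℤ.∣-i∣≡∣i∣ (+ i))) (trans (cong (λ u → ∣ proj₁ (proj₂ u) ∣) (rotate-injective r e)) (ℤ.∣-i∣≡∣i∣ (+ j)))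
sidePoint-injective n (r , false) e = cong (λ u → ∣ proj₁ (proj₂ u) ∣) (rotate-injective r e)

All-concatMap⁺ : ∀ {a b p} {A : Set a} {B : Set b} {P : Pred B p} (L : A → List B) js → (∀ j → All P (L j)) → All P (concatMap L js)
All-concatMap⁺ L js h = All.concat⁺ (All.map⁺ (All.universal h js))

-- The key tells from which sublist an element comes, so different sublists are disjoint.
concatMap-unique : ∀ {a b} {A : Set a} {B : Set b} (key : B → A) (L : A → List B) {js} →
  (∀ j → Unique (L j)) → (∀ j → All (λ y → key y ≡ j) (L j)) → Unique js → Unique (concatMap L js)
concatMap-unique key L {js} L! keys js! = AllPairs.concat⁺ (All.map⁺ (All.universal L! js))
  (AllPairs.map⁺ (AllPairs.map (λ {i} {j} i≢j → All.map (λ ≡i → All.map (λ ≡j x≡y → i≢j (trans (sym ≡i) (trans (cong key x≡y) ≡j))) (keys j)) (keys i)) js!))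

side-shape : ∀ n s → All (λ u → IsCube u × norm u ≡ n) (side n s)
side-shape n s = All.applyUpTo⁺₁ _ _ λ i< → sidePoint-isCube n s i< , norm-sidePoint n s i<

sphere-shape : ∀ n → All (λ u → IsCube u × norm u ≡ n) (sphere n)
sphere-shape n = All-concatMap⁺ (side n) sides (side-shape n)

sides-unique : Unique sides
sides-unique = toWitness {a? = DecUnique.unique? (≡-dec Fin._≟_ Bool._≟_) sides} _

sphere-unique : ∀ n → Unique (sphere (2 + n))
sphere-unique n = concatMap-unique sideOf (side (2 + n))
  (λ s → AllPairs.applyUpTo⁺₁ _ _ λ i<j _ e → <⇒≢ i<j (sidePoint-injective (2 + n) s e))
  (λ s → All.applyUpTo⁺₂ _ _ (sideOf-sidePoint n s)) sides-unique

-- Applied to the positive and the negative part of a vertex, this shows that the norm determines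
-- both.
halves : ∀ {a b} → a ≡ b ⊎ a ≡ suc b → ⌈ a + b /2⌉ ≡ a × ⌊ a + b /2⌋ ≡ b
halves {a} (inj₁ refl) = sym (n≡⌈n+n/2⌉ a) , sym (n≡⌊n+n/2⌋ a)
halves {b = b} (inj₂ refl) = cong suc (sym (n≡⌊n+n/2⌋ b)) , sym (n≡⌈n+n/2⌉ b)

side⊆sphere : ∀ s {n u} → u ∈ side n s → u ∈ sphere n
side⊆sphere s {n} u∈ = ∈-concatMap⁺ (side n) (Any.map (λ { refl → u∈ }) (all-sides s))
  where
  all-sides : ∀ s → s ∈ sides
  all-sides (zero , true)            = here refl
  all-sides (suc zero , true)        = there (here refl)
  all-sides (suc (suc zero) , true)  = there (there (here refl))
  all-sides (zero , false)           = there (there (there (here refl)))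
  all-sides (suc zero , false)       = there (there (there (there (here refl))))
  all-sides (suc (suc zero) , false) = there (there (there (there (there (here refl)))))

outward∈sphere : ∀ r {a i j n} → ⌈ n /2⌉ ≡ a → ⌊ n /2⌋ ≡ i + suc j → rotate r (+ a , ℤ.- + i , -[1+ j ]) ∈ sphere n
outward∈sphere r {a} {i} {j} {n} ea eb = subst (_∈ sphere n)
  (cong₂ (λ x y → rotate r (+ x , ℤ.- + i , -[1+ y ])) ea (trans (cong (_∸ suc i) (trans eb (+-suc i j))) (m+n∸m≡n i j)))
  (side⊆sphere (r , true) (∈-applyUpTo⁺ (sidePoint n (r , true)) (≤-trans (m≤m+n (suc i) j) (≤-reflexive (sym (trans eb (+-suc i j)))))))

inward∈sphere : ∀ r {b i j n} → ⌈ n /2⌉ ≡ i + suc j → ⌊ n /2⌋ ≡ suc b → rotate r (-[1+ b ] , + i , + suc j) ∈ sphere n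
inward∈sphere r {b} {i} {j} {n} ea eb = subst (_∈ sphere n)
  (cong₂ (λ x y → rotate r (ℤ.- + x , + i , + suc y)) eb (trans (cong (_∸ suc i) (trans ea (+-suc i j))) (m+n∸m≡n i j)))
  (side⊆sphere (r , false) (∈-applyUpTo⁺ (sidePoint n (r , false)) (≤-trans (m≤m+n (suc i) j) (≤-reflexive (sym (trans ea (+-suc i j)))))))

-- The radius fixes both parts, and the signs of the coordinates then pick the side, as in `sideOf`.
-- If no coordinate is negative, or all are, one part is 0, which a radius of at least 2 excludes.
sphere-complete : ∀ {u n} → IsCube u → norm u ≡ 2 + n → u ∈ sphere (2 + n)
sphere-complete {u} {n} p e = locate u (proj₁ h) (proj₂ h)
  where
  h : ⌈ 2 + n /2⌉ ≡ positive u × ⌊ 2 + n /2⌋ ≡ negative u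
  h = subst (λ m → ⌈ m /2⌉ ≡ positive u × ⌊ m /2⌋ ≡ negative u) (trans (positive+negative u) e) (halves (positive-cube u p))
  a+0+0 : ∀ a → a + 0 + 0 ≡ a
  a+0+0 = ℕ-Solver.solve-∀
  a+0+b : ∀ a b → a + 0 + b ≡ b + a
  a+0+b = ℕ-Solver.solve-∀
  locate : ∀ u → ⌈ 2 + n /2⌉ ≡ positive u → ⌊ 2 + n /2⌋ ≡ negative u → u ∈ sphere (2 + n)
  locate (+ a      , -[1+ b ] , -[1+ c ]) x y = outward∈sphere zero (trans x (a+0+0 a)) y
  locate (+ a      , + zero   , -[1+ c ]) x y = outward∈sphere zero {i = 0} (trans x (a+0+0 a)) y
  locate (-[1+ a ] , -[1+ b ] , + c     ) x y = outward∈sphere (suc zero) x (trans y (+-identityʳ _))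
  locate (+ zero   , -[1+ b ] , + c     ) x y = outward∈sphere (suc zero) {i = 0} x (trans y (+-identityʳ _))
  locate (-[1+ a ] , + b      , -[1+ c ]) x y = outward∈sphere (suc (suc zero)) (trans x (+-identityʳ b)) (trans y (a+0+b (suc a) (suc c)))
  locate (-[1+ a ] , + b      , + zero  ) x y = outward∈sphere (suc (suc zero)) {i = 0} (trans x (+-identityʳ b)) (trans y (a+0+0 (suc a)))
  locate (-[1+ a ] , + b      , + suc c ) x y = inward∈sphere zero x (trans y (a+0+0 (suc a)))
  locate (+ a      , + suc b  , -[1+ c ]) x y = inward∈sphere (suc zero) (trans x (+-identityʳ _)) y
  locate (+ suc a  , -[1+ b ] , + c     ) x y = inward∈sphere (suc (suc zero)) (trans x (a+0+b (suc a) c)) (trans y (+-identityʳ _))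
  locate (+ _      , + _      , + _     ) x ()
  locate (-[1+ _ ] , -[1+ _ ] , -[1+ _ ]) () y

-- Weights along a side

weightAt-mono : ∀ k {m n} → m ≤ n → weightAt k m ≤ weightAt k n
weightAt-mono k m≤n = ⊓-monoʳ-≤ (φ k) (∸-monoˡ-≤ k (+-monoʳ-≤ 5 (⊓-monoˡ-≤ 2 m≤n)))

weightAt≤weight : ∀ {q u} k {m} → norm u ≡ q + k → m ≤ smallest u → weightAt k m ≤ weight q u
weightAt≤weight {q} {u} k e m≤ = ≤-trans (weightAt-mono k m≤)
  (≤-reflexive (cong (λ l → weightAt l (smallest u)) (sym (trans (cong (_∸ q) e) (m+n∸m≡n q k)))))

⌊n/2⌋-lower : ∀ n {m} → suc m ≤ ⌈ n /2⌉ → m ≤ ⌊ n /2⌋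
⌊n/2⌋-lower n h with ⌈n/2⌉-cases n
... | inj₁ e = ≤-trans (n≤1+n _) (≤-trans h (≤-reflexive e))
... | inj₂ e = s≤s⁻¹ (≤-trans h (≤-reflexive e))

1≤smallest : ∀ n s {i} → 0 < i → i < sideLength n (proj₂ s) → 1 ≤ smallest (sidePoint n s i)
1≤smallest n (r , true) {suc i} 0<i i< = ≤-smallest-rotate r (≤-trans (≤-trans 0<i (<⇒≤ i<)) (⌊n/2⌋≤⌈n/2⌉ n)) (s≤s z≤n) (s≤s z≤n)
1≤smallest n (r , false) {i} 0<i i< = ≤-smallest-rotate r
  (≤-trans (⌊n/2⌋-lower n (≤-trans (s≤s 0<i) i<)) (≤-reflexive (sym (ℤ.∣-i∣≡∣i∣ (+ ⌊ n /2⌋))))) 0<i (s≤s z≤n)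

-- Besides `i` = 0 and `i` = 1 the last vertex of the side is left out, since its third coordinate
-- before rotation is 1 or -1.
2≤smallest : ∀ n s {i} → 2 ≤ i → 2 + i ≤ sideLength n (proj₂ s) → 2 ≤ smallest (sidePoint n s i)
2≤smallest n (r , true) {i} 2≤i i< = ≤-smallest-rotate r (≤-trans (≤-trans (m≤m+n 2 i) i<) (⌊n/2⌋≤⌈n/2⌉ n))
  (≤-trans 2≤i (≤-reflexive (sym (ℤ.∣-i∣≡∣i∣ (+ i))))) (s≤s (m<n⇒0<n∸m i<))
2≤smallest n (r , false) {i} 2≤i i< = ≤-smallest-rotate r
  (≤-trans (⌊n/2⌋-lower n (≤-trans (s≤s (m≤n+m 2 (suc (i ∸ 2)))) (≤-trans (s≤s (s≤s (≤-reflexive (m∸n+n≡m 2≤i)))) i<)))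
    (≤-reflexive (sym (ℤ.∣-i∣≡∣i∣ (+ ⌊ n /2⌋))))) 2≤i (s≤s (m<n⇒0<n∸m i<))

module _ {a} {A : Set a} (g : A → ℕ) where

  sum-lower : ∀ (f : ℕ → A) L {b} → (∀ {i} → i < L → b ≤ g (f i)) → L * b ≤ sum (map g (applyUpTo f L))
  sum-lower f zero    h = z≤n
  sum-lower f (suc L) h = +-mono-≤ (h (s≤s z≤n)) (sum-lower (f ∘ suc) L (h ∘ s≤s))

  -- The term `c` pays for the deficit at index 0, the corner of a side.
  sum-lower₁ : ∀ (f : ℕ → A) L {b c} → (∀ {i} → i < L → b ≤ g (f i) + c) → (∀ {i} → 0 < i → i < L → b ≤ g (f i)) →
    L * b ≤ sum (map g (applyUpTo f L)) + c
  sum-lower₁ f zero            h₀ h = z≤n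
  sum-lower₁ f (suc L) {b} {c} h₀ h = ≤-by 0 (+-mono-≤ (h₀ (s≤s z≤n)) (sum-lower (f ∘ suc) L (h (s≤s z≤n) ∘ s≤s)))
    (lem b c (L * b) (g (f 0)) _)
    where lem : ∀ b c x y z → b + x + (y + c + z) + 0 ≡ (y + z) + c + (b + x)
          lem = ℕ-Solver.solve-∀

  sum-upper₁ : ∀ (f : ℕ → A) L {b c} → (∀ {i} → i < L → g (f i) ≤ b + c) → (∀ {i} → 0 < i → i < L → g (f i) ≤ b) →
    sum (map g (applyUpTo f L)) ≤ L * b + c
  sum-upper₁ f zero            h₀ h = z≤n
  sum-upper₁ f (suc L) {b} {c} h₀ h = ≤-by 0 (+-mono-≤ (h₀ (s≤s z≤n)) (upper (f ∘ suc) L (h (s≤s z≤n) ∘ s≤s)))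
    (lem b c (L * b) (g (f 0)) _)
    where
    upper : ∀ (f : ℕ → A) L → (∀ {i} → i < L → g (f i) ≤ b) → sum (map g (applyUpTo f L)) ≤ L * b
    upper f zero    h = z≤n
    upper f (suc L) h = +-mono-≤ (h (s≤s z≤n)) (upper (f ∘ suc) L (h ∘ s≤s))
    lem : ∀ b c x y z → y + z + (b + c + x) + 0 ≡ (b + x) + c + (y + z)
    lem = ℕ-Solver.solve-∀

  sum-lower-tail : ∀ (f : ℕ → A) L → (∀ {i} → i < L → 1 ≤ g (f i)) → (∀ {i} → 2 + i ≤ L → 2 ≤ g (f i)) →
    L * 2 ≤ sum (map g (applyUpTo f L)) + 1
  sum-lower-tail f 0             h₁ h₂ = z≤n
  sum-lower-tail f 1             h₁ h₂ = +-monoˡ-≤ 1 (≤-trans (h₁ (s≤s z≤n)) (m≤m+n _ 0))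
  sum-lower-tail f (suc (suc L)) h₁ h₂ = ≤-trans (+-mono-≤ (h₂ (s≤s (s≤s z≤n))) (sum-lower-tail (f ∘ suc) (suc L) (h₁ ∘ s≤s) (h₂ ∘ s≤s)))
    (≤-reflexive (sym (+-assoc (g (f 0)) _ 1)))

  -- The 4 collects a deficit of 2 at the corner, 1 at the next vertex and 1 at the last one.
  sum-lower₂ : ∀ (f : ℕ → A) L → (∀ {i} → 0 < i → i < L → 1 ≤ g (f i)) → (∀ {i} → 2 ≤ i → 2 + i ≤ L → 2 ≤ g (f i)) →
    L * 2 ≤ sum (map g (applyUpTo f L)) + 4
  sum-lower₂ f 0             h₁ h₂ = z≤n
  sum-lower₂ f 1             h₁ h₂ = ≤-trans (m≤m+n 2 2) (m≤n+m 4 _)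
  sum-lower₂ f (suc (suc L)) h₁ h₂ = ≤-by (g (f 0)) (+-mono-≤ (h₁ {1} (s≤s z≤n) (s≤s (s≤s z≤n)))
      (sum-lower-tail (λ i → f (2 + i)) L (λ i< → h₁ (s≤s z≤n) (s≤s (s≤s i<))) (λ i< → h₂ (s≤s (s≤s z≤n)) (s≤s (s≤s i<)))))
    (lem (L * 2) (g (f 0)) (g (f 1)) _)
    where lem : ∀ x y z t → 2 + (2 + x) + (z + (t + 1)) + y ≡ y + (z + t) + 4 + (1 + x)
          lem = ℕ-Solver.solve-∀

  sum-concatMap : ∀ {b} {B : Set b} (L : B → List A) js → sum (map g (concatMap L js)) ≡ sum (map (λ j → sum (map g (L j))) js)
  sum-concatMap L []       = refl
  sum-concatMap L (j ∷ js) = trans (cong sum (List.map-++ g (L j) (concatMap L js)))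
    (trans (sum-++ (map g (L j)) (map g (concatMap L js))) (cong (λ z → sum (map g (L j)) + z) (sum-concatMap L js)))

-- The total weight

module _ (g : Cube → ℕ) where

  private
    sideSum : ℕ → Side → ℕ
    sideSum n s = sum (map g (side n s))

    -- Three sides have length `⌊ n /2⌋` and three `⌈ n /2⌉`, together 3n.
    total-length : ∀ n b c → sum (map (λ s → sideLength n (proj₂ s) * b + c) sides) ≡ 3 * (n * b) + 6 * c
    total-length n b c = trans (lem ⌊ n /2⌋ ⌈ n /2⌉ b c) (cong (λ m → 3 * (m * b) + 6 * c) (⌊n/2⌋+⌈n/2⌉≡n n))
      where lem : ∀ x y b c → (x * b + c) + ((x * b + c) + ((x * b + c) + ((y * b + c) + ((y * b + c) + ((y * b + c) + 0))))) ≡ 3 * ((x + y) * b) + 6 * c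
            lem = ℕ-Solver.solve-∀

  sphere-upper : ∀ n b c → (∀ s → sum (map g (side n s)) ≤ sideLength n (proj₂ s) * b + c) → sum (map g (sphere n)) ≤ 3 * (n * b) + 6 * c
  sphere-upper n b c h = ≤-trans (≤-reflexive (sum-concatMap g (side n) sides))
    (≤-trans (go sides) (≤-reflexive (total-length n b c)))
    where
    go : ∀ ss → sum (map (sideSum n) ss) ≤ sum (map (λ s → sideLength n (proj₂ s) * b + c) ss)
    go []       = z≤n
    go (s ∷ ss) = +-mono-≤ (h s) (go ss)

  sphere-lower : ∀ n b c → (∀ s → sideLength n (proj₂ s) * b ≤ sum (map g (side n s)) + c) → 3 * (n * b) ≤ sum (map g (sphere n)) + 6 * c
  sphere-lower n b c h = begin
    3 * (n * b)                                                    ≡⟨ +-identityʳ _ ⟨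
    3 * (n * b) + 6 * 0                                            ≡⟨ total-length n b 0 ⟨
    sum (map (λ s → sideLength n (proj₂ s) * b + 0) sides)         ≤⟨ go sides ⟩
    sum (map (sideSum n) sides) + 6 * c                            ≡⟨ cong (_+ 6 * c) (sum-concatMap g (side n) sides) ⟨
    sum (map g (sphere n)) + 6 * c                                 ∎
    where
    open ≤-Reasoning
    lem : ∀ x y z t → (x + y) + (z + t) ≡ (x + z) + (y + t)
    lem = ℕ-Solver.solve-∀
    go : ∀ ss → sum (map (λ s → sideLength n (proj₂ s) * b + 0) ss) ≤ sum (map (sideSum n) ss) + length ss * c
    go []       = z≤n
    go (s ∷ ss) = ≤-trans (+-mono-≤ (≤-trans (≤-reflexive (+-identityʳ _)) (h s)) (go ss))
      (≤-reflexive (lem (sideSum n s) c (sum (map (sideSum n) ss)) (length ss * c)))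

inner outer : ℕ → List Cube
inner q = concatMap (λ k → sphere (q + k)) (0 ∷ 1 ∷ 2 ∷ [])
outer q = concatMap (λ k → sphere (q + k)) (3 ∷ 4 ∷ 5 ∷ [])

-- The 7 is the allowance of a single new colour; each complement is the allowance of an inner
-- colour outside the ball.
Excessive : ℕ → (Cube → ℕ) → Set
Excessive q W = 7 + sum (map (λ u → 7 ∸ W u) (inner q)) < sum (map W (outer q))

-- The weights of the outer vertices add up to 21 q + 45, the complements to 7 of those of the inner ones to 21 q + 36.
weight-excessive : ∀ q → Excessive q (weight q)
weight-excessive q = subst₂ (λ x y → 7 + x < y) (sym (sum-spheres _ _ _ _)) (sym (sum-spheres _ _ _ _))
  (≤-by 1 (+-mono-≤ (+-mono-≤ upper₀ (+-mono-≤ upper₁ (+-monoˡ-≤ 0 upper₂))) (+-mono-≤ lower₃ (+-mono-≤ lower₄ (+-monoˡ-≤ 0 lower₅))))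
    (lem q (c 0) (c 1) (c 2) (s 3) (s 4) (s 5)))
  where
  s : ℕ → ℕ
  s k = sum (map (weight q) (sphere (q + k)))
  sum-spheres : ∀ g k l m → sum (map g (concatMap (λ k → sphere (q + k)) (k ∷ l ∷ m ∷ []))) ≡
    sum (map g (sphere (q + k))) + (sum (map g (sphere (q + l))) + (sum (map g (sphere (q + m))) + 0))
  sum-spheres g k l m = sum-concatMap g (λ k → sphere (q + k)) (k ∷ l ∷ m ∷ [])
  lem : ∀ q x y z t u v →
    suc (7 + (x + (y + (z + 0)))) + (3 * ((q + 0) * 2) + 6 * 0 + (3 * ((q + 1) * 2) + 6 * 1 + (3 * ((q + 2) * 3) + 6 * 1 + 0)) + (t + 6 * 1 + (u + 6 * 1 + (v + 6 * 4 + 0)))) + 1 ≡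
    t + (u + (v + 0)) + (x + (y + (z + 0)) + (3 * ((q + 3) * 3) + (3 * ((q + 4) * 2) + (3 * ((q + 5) * 2) + 0))))
  lem = ℕ-Solver.solve-∀
  c : ℕ → ℕ
  c k = sum (map (λ u → 7 ∸ weight q u) (sphere (q + k)))
  w : ∀ k m {σ i} → i < sideLength (q + k) (proj₂ σ) → m ≤ smallest (sidePoint (q + k) σ i) → weightAt k m ≤ weight q (sidePoint (q + k) σ i)
  w k m {σ} {i} i< = weightAt≤weight {u = sidePoint (q + k) σ i} k (norm-sidePoint (q + k) σ i<)
  -- At level 0 the weight is constant. At levels 1 to 4 it is guaranteed to be one below the
  -- regular value at most at the corner of each side, which costs 6 per sphere; level 5 costs 4 per
  -- side.
  upper₀ : c 0 ≤ 3 * ((q + 0) * 2) + 6 * 0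
  upper₀ = sphere-upper _ (q + 0) 2 0 λ σ → sum-upper₁ _ _ _ (λ i< → ∸-monoʳ-≤ 7 (w 0 0 {σ} i< z≤n)) (λ 0<i i< → ∸-monoʳ-≤ 7 (w 0 0 {σ} i< z≤n))
  upper₁ : c 1 ≤ 3 * ((q + 1) * 2) + 6 * 1
  upper₁ = sphere-upper _ (q + 1) 2 1 λ σ → sum-upper₁ _ _ _ (λ i< → ∸-monoʳ-≤ 7 (w 1 0 {σ} i< z≤n)) (λ 0<i i< → ∸-monoʳ-≤ 7 (w 1 1 {σ} i< (1≤smallest (q + 1) σ 0<i i<)))
  upper₂ : c 2 ≤ 3 * ((q + 2) * 3) + 6 * 1
  upper₂ = sphere-upper _ (q + 2) 3 1 λ σ → sum-upper₁ _ _ _ (λ i< → ∸-monoʳ-≤ 7 (w 2 0 {σ} i< z≤n)) (λ 0<i i< → ∸-monoʳ-≤ 7 (w 2 1 {σ} i< (1≤smallest (q + 2) σ 0<i i<)))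
  lower₃ : 3 * ((q + 3) * 3) ≤ s 3 + 6 * 1
  lower₃ = sphere-lower _ (q + 3) 3 1 λ σ → sum-lower₁ _ _ _ (λ i< → +-monoˡ-≤ 1 (w 3 0 {σ} i< z≤n)) (λ 0<i i< → w 3 1 {σ} i< (1≤smallest (q + 3) σ 0<i i<))
  lower₄ : 3 * ((q + 4) * 2) ≤ s 4 + 6 * 1
  lower₄ = sphere-lower _ (q + 4) 2 1 λ σ → sum-lower₁ _ _ _ (λ i< → +-monoˡ-≤ 1 (w 4 0 {σ} i< z≤n)) (λ 0<i i< → w 4 1 {σ} i< (1≤smallest (q + 4) σ 0<i i<))
  lower₅ : 3 * ((q + 5) * 2) ≤ s 5 + 6 * 4
  lower₅ = sphere-lower _ (q + 5) 2 4 λ σ → sum-lower₂ _ _ _ (λ 0<i i< → w 5 1 {σ} i< (1≤smallest (q + 5) σ 0<i i<))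
    (λ 2≤i i< → w 5 2 {σ} (≤-trans (n≤1+n _) i<) (2≤smallest (q + 5) σ 2≤i i<))

-- Small radii

far? : ∀ q u v → Dec (Far q u v)
far? q u v = 5 + 2 * q ≤? dist u v

module _ (q : ℕ) (W : Cube → ℕ) where

  -- us are the candidates left: the vertices far from all those chosen so far.
  bounded : ℕ → ℕ → List Cube → Bool
  bounded zero       budget us = null us
  bounded (suc fuel) budget us = all (λ u → (W u ≤ᵇ budget) ∧ bounded fuel (budget ∸ W u) (filter (far? q u) us)) us

  -- The head is paid from the budget, and the other vertices are far from it, so they survive the
  -- filter and the induction continues with them. Without fuel there are no candidates left.
  bounded-sound : ∀ fuel budget us → T (bounded fuel budget us) → ∀ vs → All (_∈ us) vs → AllPairs (Far q) vs → sum (map W vs) ≤ budget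
  bounded-sound fuel       budget us ok [] _ _ = z≤n
  bounded-sound zero       budget [] ok (v ∷ vs) (() ∷ _) _
  bounded-sound (suc fuel) budget us ok (v ∷ vs) (v∈ ∷ vs∈) (far ∷ fars)
    with Wv≤ , rest ← Equivalence.to Bool.T-∧ (All.lookup (All.all⁺ _ us ok) v∈) = begin
    W v + sum (map W vs)   ≤⟨ +-monoʳ-≤ (W v) (bounded-sound fuel (budget ∸ W v) (filter (far? q v) us) rest vs
                                (All.zipWith (λ (v∈ , far) → ∈-filter⁺ (far? q v) v∈ far) (vs∈ , far)) fars) ⟩
    W v + (budget ∸ W v)   ≡⟨ m+[n∸m]≡n (≤ᵇ⇒≤ (W v) budget Wv≤) ⟩
    budget                 ∎
    where open ≤-Reasoning

shells : ℕ → List Cube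
shells q = concatMap (λ k → sphere (q + k)) (0 ∷ 1 ∷ 2 ∷ 3 ∷ 4 ∷ 5 ∷ [])

sphere⊆concatMap : ∀ {q u ks} k → IsCube u → norm u ≡ 2 + q + k → k ∈ ks → u ∈ concatMap (λ k → sphere (2 + q + k)) ks
sphere⊆concatMap {q} {u} k p e k∈ = ∈-concatMap⁺ (λ k → sphere (2 + q + k)) (Any.map (λ { refl → sphere-complete p e }) k∈)

shell⇒∈shells : ∀ {q u} → Shell (2 + q) u → u ∈ shells (2 + q)
shell⇒∈shells {q} (shell p k k≤5 e) = sphere⊆concatMap {q} k p e (small k≤5)
  where
  small : ∀ {k} → k ≤ 5 → k ∈ 0 ∷ 1 ∷ 2 ∷ 3 ∷ 4 ∷ 5 ∷ []
  small {0} _ = here refl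
  small {1} _ = there (here refl)
  small {2} _ = there (there (here refl))
  small {3} _ = there (there (there (here refl)))
  small {4} _ = there (there (there (there (here refl))))
  small {5} _ = there (there (there (there (there (here refl)))))
  small {suc (suc (suc (suc (suc (suc _)))))} (s≤s (s≤s (s≤s (s≤s (s≤s ())))))

-- With fuel 5 and budget 7 the evaluation also rules out six pairwise far vertices.
bounded⇒farBounded : ∀ q W → T (bounded (2 + q) W 5 7 (shells (2 + q))) → FarBounded (2 + q) W
bounded⇒farBounded q W ok us inShell = bounded-sound (2 + q) W 5 7 _ ok us (All.map shell⇒∈shells inShell)

-- For q = 3, two of the rotations of (4 , -2 , -2) form a far triple of weight 8 under weight 3 together with the remaining
-- rotation of (3 , -1 , -1). Lowering the former from 2 to 1 is paid for by raising (-1 , 1 , 1) from 5 to 6.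
weight₃ : Cube → ℕ
weight₃ u with norm u | smallest u | sideOf u
... | 3 | suc _       | _        = 6
... | 8 | suc (suc _) | _ , true = 1
... | _ | _           | _        = weight 3 u

-- The overlap argument starts at q = 7, so q from 3 to 6 is left to the search. For q = 3 the
-- excess is evaluated as well, since the weight is modified there.
weighting : ∀ q → 3 ≤ q → ∃[ W ] FarBounded q W × Excessive q W
weighting 0 ()
weighting 1 (s≤s ())
weighting 2 (s≤s (s≤s ()))
weighting 3 _ = weight₃ , bounded⇒farBounded 1 weight₃ _ , toWitness {a? = _ <? _} _
weighting 4 _ = weight 4 , bounded⇒farBounded 2 (weight 4) _ , weight-excessive 4
weighting 5 _ = weight 5 , bounded⇒farBounded 3 (weight 5) _ , weight-excessive 5
weighting 6 _ = weight 6 , bounded⇒farBounded 4 (weight 6) _ , weight-excessive 6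
weighting q@(suc (suc (suc (suc (suc (suc (suc _))))))) _ = weight q , weight-far (m≤m+n 7 _) , weight-excessive q

-- Colourings

data Outer (q : ℕ) (u : Cube) : Set where
  outerAt : ∀ k → IsCube u → norm u ≡ q + k → 3 ≤ k → k ≤ 5 → Outer q u

concat-spheres : ∀ q ks {p} {P : Pred Cube p} → All (λ k → ∀ {u} → IsCube u → norm u ≡ q + k → P u) ks →
  All P (concatMap (λ k → sphere (q + k)) ks)
concat-spheres q ks h = All.concat⁺ (All.map⁺ (All.map (λ {k} h → All.map (λ (p , e) → h p e) (sphere-shape (q + k))) h))

outer-shape : ∀ q → All (Outer q) (outer q)
outer-shape q = concat-spheres q _
  ((λ p e → outerAt 3 p e ≤-refl (m≤m+n 3 2)) ∷ (λ p e → outerAt 4 p e (m≤m+n 3 1) (m≤m+n 4 1)) ∷ (λ p e → outerAt 5 p e (m≤m+n 3 2) ≤-refl) ∷ [])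

inner-shape : ∀ q → All (λ u → Shell q u × norm u ≤ q + 2) (inner q)
inner-shape q = concat-spheres q _
  (at 0 z≤n ∷ at 1 (s≤s z≤n) ∷ at 2 ≤-refl ∷ [])
  where
  at : ∀ k → k ≤ 2 → ∀ {u} → IsCube u → norm u ≡ q + k → Shell q u × norm u ≤ q + 2
  at k k≤2 p e = shell p k (≤-trans k≤2 (m≤m+n 2 3)) e , ≤-trans (≤-reflexive e) (+-monoʳ-≤ q k≤2)

outer-unique : ∀ q → Unique (outer (2 + q))
outer-unique q = concatMap-unique (λ u → norm u ∸ (2 + q)) (λ k → sphere (2 + q + k))
  (λ k → sphere-unique (q + k))
  (λ k → All.map (λ (_ , e) → trans (cong (_∸ (2 + q)) e) (m+n∸m≡n (2 + q) k)) (sphere-shape (2 + q + k)))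
  (toWitness {a? = DecUnique.unique? _≟_ (3 ∷ 4 ∷ 5 ∷ [])} _)

inner-complete : ∀ {q u} → IsCube u → 2 + q ≤ norm u → norm u ≤ 2 + q + 2 → u ∈ inner (2 + q)
inner-complete {q} {u} p l h = sphere⊆concatMap {q} (norm u ∸ (2 + q)) p (sym (m+[n∸m]≡n l))
  (small (+-cancelˡ-≤ (2 + q) _ 2 (≤-trans (≤-reflexive (m+[n∸m]≡n l)) h)))
  where
  small : ∀ {k} → k ≤ 2 → k ∈ 0 ∷ 1 ∷ 2 ∷ []
  small {0} _ = here refl
  small {1} _ = there (here refl)
  small {2} _ = there (there (here refl))
  small {suc (suc (suc _))} (s≤s (s≤s ()))

dist≤norm+norm : ∀ u v → dist u v ≤ norm u + norm v
dist≤norm+norm u v = ≤-trans (m≤m+n _ (2 * shared u v)) (≤-reflexive (dist+shared u v))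

outer⇒shell : ∀ {q u} → Outer q u → Shell q u
outer⇒shell (outerAt k p e _ k≤5) = shell p k k≤5 e

inner≢outer : ∀ {q u v} → norm u ≤ q + 2 → Outer q v → u ≢ v
inner≢outer {q} u≤ (outerAt k _ e 3≤k _) refl = <⇒≱ (≤-trans (≤-reflexive (sym (+-suc q 2))) (+-monoʳ-≤ q 3≤k)) (≤-trans (≤-reflexive (sym e)) u≤)

-- Comparing all entries with the head suffices. The colour argument is a default for the empty
-- list, which supplies none.
monochromatic : ∀ {a} {A : Set a} {n} (f : A → Fin n) → Fin n → ∀ xs →
  (∃[ x ] ∃[ y ] x ∈ xs × y ∈ xs × f x ≢ f y) ⊎ (∃[ c ] All (λ x → f x ≡ c) xs)
monochromatic f c []       = inj₂ (c , [])
monochromatic f c (x ∷ xs) with All.all? (λ y → f y Fin.≟ f x) xs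
... | yes same = inj₂ (f x , refl ∷ same)
... | no ¬same with y , y∈ , fy≢fx ← find (All.¬All⇒Any¬ (λ y → f y Fin.≟ f x) xs ¬same) =
  inj₁ (x , y , here refl , there y∈ , ≢-sym fy≢fx)

module _ {x₁ x₂ : ℤ} (x-right : IsRight (x₁ , x₂)) {n q : ℕ} (f : Vertex → Fin n)
  (coloring : IsDistanceColoring (2 * (2 + (2 + q))) f) {W : Cube → ℕ}
  (farBounded : FarBounded (2 + q) W) (excessive : Excessive (2 + q) W) where

  open Lattice x₁ x₂ x-right
  open DecMembership (Fin._≟_ {n}) using (_∈?_)

  private
    x : Vertex
    x = x₁ , x₂

    r : ℕ
    r = 2 + q

    color : Cube → Fin n
    color u = f (emb u)

  emb-origin : emb origin ≡ x
  emb-origin = cong₂ _,_ (ℤ.+-identityʳ x₁) (ℤ.+-identityʳ x₂)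

  same-color⇒far : ∀ {u v} → IsCube u → IsCube v → u ≢ v → color u ≡ color v → Far r u v
  same-color⇒far {u} {v} p p′ u≢v same with dist u v ≤? 2 * (2 + r)
  ... | yes d≤ = contradiction same (coloring (u≢v ∘ emb-injective p p′) (dist u v , emb-d p p′ , d≤))
  ... | no  d≰ = ≤-trans (s≤s (≤-reflexive (sym (*-distribˡ-+ 2 2 r)))) (≰⇒> d≰)

  class-far : ∀ {us c} → Unique us → All IsCube us → All (λ u → color u ≡ c) us → AllPairs (Far r) us
  class-far []         []       []       = []
  class-far (u∉ ∷ us!) (p ∷ ps) (e ∷ es) =
    All.zipWith (λ (u≢v , p′ , e′) → same-color⇒far p p′ u≢v (trans e (sym e′))) (u∉ , All.zip (ps , es)) ∷ class-far us! ps es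

  innerColors : List (Fin n)
  innerColors = map color (inner r)

  new? : Decidable (λ u → ¬ (color u ∈ innerColors))
  new? u = ¬? (color u ∈? innerColors)

  outer-𝓕 : ∀ {u} → Outer r u → (𝓕 x (2 + r + 1) ∪ 𝓕 x (2 + r + 2) ∪ 𝓕 x (2 + r + 3)) (emb u)
  outer-𝓕 {u} (outerAt k p e 3≤k k≤5) = locate k 3≤k k≤5 e
    where
    d-norm : ∀ {m} → norm u ≡ m → d x (emb u) m
    d-norm {m} e = subst₂ (λ y l → d y (emb u) l) emb-origin (trans (dist-sym origin u) (trans (dist-origin u) e)) (emb-d {origin} (inj₁ refl) p)
    shift-level : ∀ k → r + (2 + k) ≡ 2 + r + k
    shift-level k = trans (sym (+-assoc r 2 k)) (cong (_+ k) (+-comm r 2))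
    locate : ∀ k → 3 ≤ k → k ≤ 5 → norm u ≡ r + k → (𝓕 x (2 + r + 1) ∪ 𝓕 x (2 + r + 2) ∪ 𝓕 x (2 + r + 3)) (emb u)
    locate 3 _ _ e = inj₁ (d-norm (trans e (shift-level 1)))
    locate 4 _ _ e = inj₂ (inj₁ (d-norm (trans e (shift-level 2))))
    locate 5 _ _ e = inj₂ (inj₂ (d-norm (trans e (shift-level 3))))
    locate 1 (s≤s ())
    locate 2 (s≤s (s≤s ()))
    locate (suc (suc (suc (suc (suc (suc _)))))) _ (s≤s (s≤s (s≤s (s≤s (s≤s ())))))

  -- A ball vertex `v` sharing the colour of `u` is far from it. As `u` has norm at most `r + 5`,
  -- the path through the origin forces `v` to have norm at least `r`, so `v` is an inner vertex and
  -- its colour is listed.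
  new⇒∉VD : ∀ {u} → Outer r u → ¬ (color u ∈ innerColors) → ¬ Image f (VD x (2 + r)) (color u)
  new⇒∉VD {u} o@(outerAt k p e _ k≤5) new (w , (l , (walk , _) , l≤) , fw≡) with emb-surjective w
  ... | v , p′ , refl = new (subst (_∈ innerColors) fw≡ (∈-map⁺ color (inner-complete p′ r≤norm norm≤)))
    where
    norm≤ : norm v ≤ r + 2
    norm≤ = begin
      norm v         ≡⟨ dist-origin v ⟨
      dist v origin  ≤⟨ walk⇒dist {v} {origin} p′ (inj₁ refl) refl (subst (λ y → Walk (emb v) y l) (sym emb-origin) walk) ⟩
      l              ≤⟨ l≤ ⟩
      2 + r          ≡⟨ +-comm 2 r ⟩
      r + 2          ∎
      where open ≤-Reasoning
    r≤norm : r ≤ norm v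
    r≤norm = ≤-by 0 (+-mono-≤ (same-color⇒far p p′ (≢-sym (inner≢outer norm≤ o)) (sym fw≡))
        (+-mono-≤ (dist≤norm+norm u v) (+-mono-≤ (≤-reflexive e) k≤5)))
      (lem r (dist u v) (norm u) (norm v) k)
      where
      lem : ∀ r d a b k → r + (d + ((a + b) + ((r + k) + 5))) + 0 ≡ b + (5 + 2 * r + (d + (a + k)))
      lem = ℕ-Solver.solve-∀

  few-new-colors-impossible : ∀ c → ¬ All (λ u → color u ≡ c) (filter new? (outer r))
  few-new-colors-impossible c same = <⇒≱ excessive
    (subst (λ ns → sum (map W (outer r)) ≤ 7 + sum ns) (sym (List.map-∘ (inner r)))
      (sum-by-class W Fin._≟_ color caps (outer r) (All.tabulate covered) (class≤7 ∷ All.map⁺ (All.map class≤ (inner-shape r)))))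
    where
    caps : List (Fin n × ℕ)
    caps = (c , 7) ∷ map (λ v → color v , 7 ∸ W v) (inner r)
    covered : ∀ {u} → u ∈ outer r → color u ∈ map proj₁ caps
    covered {u} u∈ with color u ∈? innerColors
    ... | yes old = there (subst (color u ∈_) (List.map-∘ (inner r)) old)
    ... | no  new = here (All.lookup same (∈-filter⁺ new? u∈ new))
    class-outer : ∀ c → All (Outer r) (class W Fin._≟_ color c (outer r))
    class-outer c = All.filter⁺ (λ u → color u Fin.≟ c) (outer-shape r)
    class-color : ∀ c → All (λ u → color u ≡ c) (class W Fin._≟_ color c (outer r))
    class-color c = All.all-filter (λ u → color u Fin.≟ c) (outer r)
    class-allFar : ∀ c → AllPairs (Far r) (class W Fin._≟_ color c (outer r))
    class-allFar c = class-far (Unique.filter⁺ (λ u → color u Fin.≟ c) (outer-unique q))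
      (All.map (isCube ∘ outer⇒shell) (class-outer c)) (class-color c)
    class≤7 : sum (map W (class W Fin._≟_ color c (outer r))) ≤ 7
    class≤7 = farBounded _ (All.map outer⇒shell (class-outer c)) (class-allFar c)
    -- Put in front of the outer vertices of its colour, `v` still forms a far list with them, so
    -- its weight comes off the 7.
    class≤ : ∀ {v} → Shell r v × norm v ≤ r + 2 → sum (map W (class W Fin._≟_ color (color v) (outer r))) ≤ 7 ∸ W v
    class≤ {v} (s , v≤) = m+n≤o⇒m≤o∸n _ (≤-trans (≤-reflexive (+-comm _ (W v))) (farBounded (v ∷ _) (s ∷ All.map outer⇒shell (class-outer (color v)))
      (All.zipWith (λ (o , e) → same-color⇒far (isCube s) (isCube (outer⇒shell o)) (inner≢outer v≤ o) (sym e)) (class-outer (color v) , class-color (color v))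
        ∷ class-allFar (color v))))

  two-new-colors : AtLeastTwo (Image f (𝓕 x (2 + r + 1) ∪ 𝓕 x (2 + r + 2) ∪ 𝓕 x (2 + r + 3)) ∖ Image f (VD x (2 + r)))
  two-new-colors with monochromatic color (color origin) (filter new? (outer r))
  ... | inj₂ (c , same) = contradiction same (few-new-colors-impossible c)
  ... | inj₁ (u , v , u∈ , v∈ , fu≢fv) = color u , color v , fu≢fv , witness u∈ , witness v∈
    where
    witness : ∀ {u} → u ∈ filter new? (outer r) →
      (Image f (𝓕 x (2 + r + 1) ∪ 𝓕 x (2 + r + 2) ∪ 𝓕 x (2 + r + 3)) ∖ Image f (VD x (2 + r))) (color u)
    witness {u} u∈ with u∈outer , new ← ∈-filter⁻ new? u∈ =
      let o = All.lookup (outer-shape r) u∈outer in (emb u , outer-𝓕 o , refl) , new⇒∉VD o new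

theorem2 : ∀ (p : ℕ) → 5 ≤ p →
    ∀ (x : Vertex) → IsRight x →
    ∀ (n : ℕ) (f : Vertex → Fin n) → IsDistanceColoring (2 * p) f →
    AtLeastTwo (Image f (𝓕 x (p + 1) ∪ 𝓕 x (p + 2) ∪ 𝓕 x (p + 3)) ∖ Image f (VD x p))
theorem2 (suc (suc (suc zero))) (s≤s (s≤s (s≤s ())))
-- Here `q` is p - 4, so the levels start at `2 + q` = p - 2; the bound p ≥ 5 makes this at least 3,
-- as `weighting` asks.
theorem2 (suc (suc (suc (suc q)))) (s≤s (s≤s 3≤r)) (x₁ , x₂) x-right n f coloring
  with W , farBounded , excessive ← weighting (2 + q) 3≤r = two-new-colors x-right f coloring farBounded excessive
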